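{- Fix $r\ge0$ and $n\ge0$. The map $\pi\mapsto(P_d^r(\pi),Q_d^r(\pi))$ is a bijection from $B_n$ onto the set of pairs $(P,Q)$ of standard domino tableaux of the same shape $\lambda\in\mathcal P_r(n)$. Moreover, for every $\pi\in B_n$, \[ tc(\pi)=sp(P_d^r(\pi))+sp(Q_d^r(\pi)), \] where $tc(\pi)$ is the number of barred letters of $\pi$.
   Context: Partitions are identified with Young diagrams in English notation: cell $(k,l)$ lies in row $k$ (from the top) and column $l$ (from the left). A domino is a set of two cells sharing an edge (vertical if in one column). $\delta_r=(r,r-1,\dots,1)$; every partition has a 2-core (obtained by repeatedly removing dominoes while staying a partition) equal to a unique $\delta_r$; $\mathcal P_r(n)$ is the set of partitions with 2-core $\delta_r$ and size $|\delta_r|+2n$. A standard domino tableau (SDT) of shape $\lambda\in\mathcal P_r(n)$ is a chain $\delta_r=\lambda^0\subset\cdots\subset\lambda^n=\lambda$ with each $\lambda^k/\lambda^{k-1}$ a domino; $sp(D)$ is half the number of vertical dominoes. $B_n$ is the set of words $\pi=\pi_1\cdots\pi_n$ in letters $\{1,\dots,n,\bar1,\dots,\bar n\}$ in which each $k\in[n]$ occurs exactly once, barred or unbarred. Growth diagram: $M(i,j)=1$ if $\pi_i=j$, $-1$ if $\pi_i=\bar j$, $0$ otherwise. Partitions $\lambda_{(i,j)}$, $1\le i,j\le n+1$, with $\lambda_{(1,j)}=\lambda_{(i,1)}=\delta_r$; for $i,j\in[n]$, with $\lambda=\lambda_{(i,j)},\mu=\lambda_{(i+1,j)},\nu=\lambda_{(i,j+1)}$,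 $\rho=\lambda_{(i+1,j+1)}$ is: (1) if $M(i,j)=1$ (then $\lambda=\mu=\nu$), $\lambda$ with two cells appended to its first row; (2) if $M(i,j)=-1$ (then $\lambda=\mu=\nu$), $\lambda$ with two cells appended to its first column; (3) if $M(i,j)=0$ and $\lambda=\mu$ or $\lambda=\nu$, the largest of $\lambda,\mu,\nu$; (4) otherwise, with dominoes $\gamma=\nu/\lambda$, $\gamma'=\mu/\lambda$: if disjoint, $\lambda\cup\gamma\cup\gamma'$; if they share exactly the cell $(k,l)$, $\lambda\cup\gamma\cup\gamma'\cup\{(k+1,l+1)\}$; if $\gamma=\gamma'$ vertical in column $l$, $\lambda\cup\gamma$ with two cells appended at the bottom of column $l+1$; if $\gamma=\gamma'$ horizontal in row $k$, $\lambda\cup\gamma$ with two cells appended at the end of row $k+1$. Consecutive partitions in the last row/column differ by one domino. $P_d^r(\pi)$ is the SDT given by the chain $\lambda_{(n+1,1)}\subset\cdots\subset\lambda_{(n+1,n+1)}$ and $Q_d^r(\pi)$ the SDT given by $\lambda_{(1,n+1)}\subset\cdots\subset\lambda_{(n+1,n+1)}$. -}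

module Defs where

open import Data.Bool using (Bool; true; false; if_then_else_)
open import Data.Fin using (Fin; toℕ; fromℕ<; fromℕ; inject₁) renaming (zero to fzero; suc to fsuc)
import Data.Fin.Properties as Fin
open import Data.Integer using (ℤ; +_; -[1+_]; 0ℤ; 1ℤ; -1ℤ)
open import Data.List using (List; []; _∷_; applyUpTo; applyDownFrom; concatMap; filter; length; upTo)
import Data.List.Membership.DecPropositional as DecMembership
open import Data.List.Properties using () renaming (≡-dec to List-≡-dec)
open import Data.List.Relation.Unary.All using (All)
open import Data.List.Relation.Unary.Linked using (Linked)
open import Data.Nat using (ℕ; zero; suc; _+_; _*_; _∸_; _⊔_; _≤_; _<_; _≥_; _≟_; _<?_)
open import Data.Nat.ListAction using (sum)
open import Data.Nat.Properties using (≤-refl; <⇒≤)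
open import Data.Product using (_×_; _,_; ∃; ∃!)
open import Data.Product.Properties using () renaming (≡-dec to ×-≡-dec)
open import Data.Rational using (ℚ; _/_)
open import Data.Vec using (Vec; []; _∷_; allFin; countᵇ; lookup; tabulate)
open import Level using (Level)
open import Relation.Binary.Construct.Closure.ReflexiveTransitive using (Star)
open import Relation.Binary.Definitions using (DecidableEquality)
open import Relation.Binary.PropositionalEquality using (_≡_)
open import Relation.Nullary using (¬_; does)
open import Relation.Unary using (Pred; _∈_)

private variable
  a b p q : Level
  m n : ℕ

-- The restriction of f to the subset P of A is a bijection onto the subset Q of B.
record BijectionOnto {A : Set a} {B : Set b} (P : Pred A p) (f : A → B) (Q : Pred B q)
                     : Set (a Level.⊔ b Level.⊔ p Level.⊔ q) where
  field
    into       : ∀ x → x ∈ P → f x ∈ Q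
    injective  : ∀ x y → x ∈ P → y ∈ P → f x ≡ f y → x ≡ y
    surjective : ∀ z → z ∈ Q → ∃ λ x → x ∈ P × f x ≡ z

-- Rows, columns, positions and letters are all numbered from 0.

-- A Young diagram is given by its list of row lengths.  The operations below
-- accept arbitrary lists; only those in IsPartition are partitions.
Diagram : Set
Diagram = List ℕ

IsPartition : Pred Diagram _
IsPartition lam = Linked _≥_ lam × All (0 <_) lam

Cell : Set
Cell = ℕ × ℕ

row : Diagram → ℕ → ℕ
row []        _       = 0
row (x ∷ _)   zero    = x
row (_ ∷ lam) (suc k) = row lam k

col : Diagram → ℕ → ℕ
col lam l = length (filter (l <?_) lam)

infix 4 _⊆_
_⊆_ : Diagram → Diagram → Set
lam ⊆ mu = ∀ k → row lam k ≤ row mu k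

-- The cells of nu not in lam, listed row by row and from left to right.
infix 6 _∖_
_∖_ : Diagram → Diagram → List Cell
nu ∖ lam = concatMap (λ k → applyUpTo (λ t → k , row lam k + t) (row nu k ∸ row lam k))
                     (upTo (length nu))

infixr 5 _∪_
_∪_ : Diagram → Diagram → Diagram
[]        ∪ mu       = mu
(x ∷ lam) ∪ []       = x ∷ lam
(x ∷ lam) ∪ (y ∷ mu) = (x ⊔ y) ∷ (lam ∪ mu)

-- This is lam ∪ {(k , l)} provided that row k of lam has length l or more;
-- it is only used in that situation.
addCell : Cell → Diagram → Diagram
addCell (zero  , l) []        = suc l ∷ []
addCell (zero  , l) (x ∷ lam) = (x ⊔ suc l) ∷ lam
addCell (suc k , l) []        = 0 ∷ addCell (k , l) []
addCell (suc k , l) (x ∷ lam) = x ∷ addCell (k , l) lam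

appendTwoToRow : ℕ → Diagram → Diagram
appendTwoToRow k lam = addCell (k , suc (row lam k)) (addCell (k , row lam k) lam)

appendTwoToCol : ℕ → Diagram → Diagram
appendTwoToCol l lam = addCell (suc (col lam l) , l) (addCell (col lam l , l) lam)

-- Cells are in the order in which _∖_ lists them.
data IsDomino : Pred (List Cell) Level.zero where
  horizontal : ∀ k l → IsDomino ((k , l) ∷ (k , suc l) ∷ [])
  vertical   : ∀ k l → IsDomino ((k , l) ∷ (suc k , l) ∷ [])

isVertical : List Cell → Bool
isVertical ((_ , l) ∷ (_ , l′) ∷ []) = does (l ≟ l′)
isVertical _                         = false

infix 4 _⋖_
_⋖_ : Diagram → Diagram → Set
lam ⋖ mu = lam ⊆ mu × IsDomino (mu ∖ lam)

δ : ℕ → Diagram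
δ r = applyDownFrom suc r

RemoveDomino : Diagram → Diagram → Set
RemoveDomino lam mu = IsPartition mu × mu ⋖ lam

HasTwoCore : Diagram → Diagram → Set
HasTwoCore lam kappa = Star RemoveDomino lam kappa × (∀ mu → ¬ RemoveDomino kappa mu)

𝒫 : ℕ → ℕ → Pred Diagram _
𝒫 r n lam = IsPartition lam × HasTwoCore lam (δ r) × sum lam ≡ sum (δ r) + 2 * n

Chain : ℕ → Set
Chain n = Vec Diagram (suc n)

IsSDT : ℕ → Diagram → Pred (Chain n) _
IsSDT {n} r lam D =
    lookup D fzero ≡ δ r
  × lookup D (fromℕ n) ≡ lam
  × (∀ k → IsPartition (lookup D k))
  × (∀ (k : Fin n) → lookup D (inject₁ k) ⋖ lookup D (fsuc k))

SDTPairs : ∀ r n → Pred (Chain n × Chain n) _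
SDTPairs r n (P , Q) = ∃ λ lam → lam ∈ 𝒫 r n × IsSDT r lam P × IsSDT r lam Q

verticals : Chain n → ℕ
verticals {n} D =
  countᵇ (λ k → isVertical (lookup D (fsuc k) ∖ lookup D (inject₁ k))) (allFin n)

sp : Chain n → ℚ
sp D = + verticals D / 2

data Letter (n : ℕ) : Set where
  unbarred barred : Fin n → Letter n

value : Letter n → Fin n
value (unbarred k) = k
value (barred k)   = k

isBarred : Letter n → Bool
isBarred (unbarred _) = false
isBarred (barred _)   = true

Word : ℕ → Set
Word n = Vec (Letter n) n

B : ∀ n → Pred (Word n) _
B n π = ∀ (k : Fin n) → ∃! _≡_ λ i → value (lookup π i) ≡ k

tc : Word n → ℕ
tc π = countᵇ isBarred π

entry : Letter n → Fin n → ℤ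
entry (unbarred k) j = if does (k Fin.≟ j) then 1ℤ else 0ℤ
entry (barred k)   j = if does (k Fin.≟ j) then -1ℤ else 0ℤ

M : Word n → Fin n → Fin n → ℤ
M π i j = entry (lookup π i) j

_≟ᶜ_ : DecidableEquality Cell
_≟ᶜ_ = ×-≡-dec _≟_ _≟_

_≟ᵈ_ : DecidableEquality Diagram
_≟ᵈ_ = List-≡-dec _≟_

open DecMembership _≟ᶜ_ using (_∈?_)

infixr 7 _∩_
_∩_ : List Cell → List Cell → List Cell
γ ∩ γ′ = filter (_∈? γ′) γ

-- The last argument is γ ∩ γ′, where γ = nu ∖ lam and γ′ = mu ∖ lam are dominoes,
-- so that nu is lam ∪ γ and mu ∪ nu is lam ∪ γ ∪ γ′.  If the intersection has
-- two cells, it is γ = γ′.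
joinDominoes : (mu nu : Diagram) → List Cell → Diagram
joinDominoes mu nu []                    = mu ∪ nu
joinDominoes mu nu ((k , l) ∷ [])        = addCell (suc k , suc l) (mu ∪ nu)
joinDominoes mu nu γ@((k , l) ∷ _ ∷ _) =
  if isVertical γ then appendTwoToCol (suc l) nu
                  else appendTwoToRow (suc k) nu

-- When the entry is 0 and lam is mu or nu, the largest of the three diagrams is
-- the other one, since lam is contained in both.
localRule : ℤ → (lam mu nu : Diagram) → Diagram
localRule (+ 1)      lam mu nu = appendTwoToRow 0 lam
localRule (-[1+ 0 ]) lam mu nu = appendTwoToCol 0 lam
localRule _          lam mu nu =
  if does (lam ≟ᵈ mu) then nu else
  if does (lam ≟ᵈ nu) then mu else
  joinDominoes mu nu ((nu ∖ lam) ∩ (mu ∖ lam))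

growth : ℕ → Word n → (i j : ℕ) → .(i ≤ n) → .(j ≤ n) → Diagram
growth r π zero    _       _   _   = δ r
growth r π (suc _) zero    _   _   = δ r
growth r π (suc i) (suc j) i<n j<n =
  localRule (M π (fromℕ< i<n) (fromℕ< j<n))
            (growth r π i       j       (<⇒≤ i<n) (<⇒≤ j<n))
            (growth r π (suc i) j       i<n       (<⇒≤ j<n))
            (growth r π i       (suc j) (<⇒≤ i<n) j<n)

P-tableau Q-tableau : ℕ → Word n → Chain n
P-tableau {n} r π = tabulate λ j → growth r π n (toℕ j) ≤-refl (Fin.toℕ≤pred[n] j)
Q-tableau {n} r π = tabulate λ i → growth r π (toℕ i) n (Fin.toℕ≤pred[n] i) ≤-refl

{-# OPTIONS --safe #-}

-- A partition is handled through its row lengths.  A domino is then an increment: 2 in row k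
-- (horizontal) or 1 in each of the equal rows k and k + 1 (vertical), and "no domino" is the
-- zero increment.  In these terms the local rule becomes a short list of cases: the dominoes on
-- two adjacent sides of a cell of the growth diagram determine those on the two opposite sides,
-- and conversely the latter determine the former together with the matrix entry.  Each case
-- preserves the number of vertical dominoes, except that an entry -1 adds two of them.
--
-- Running the rule forwards shows that both chains are tableaux; running it backwards shows that
-- they determine the word.  For surjectivity the rule is run backwards from an arbitrary pair of
-- tableaux: no domino can be removed from δ r, so the first row and column that arise are
-- constant, and along each row (column) of cells the step between the two bounding rows (columns)
-- of diagrams turns from trivial to non-trivial exactly once, at the unique non-zero entry.
-- The statement on spins is the telescoping sum of the local count of vertical dominoes.

module Submission where

open import Defs

-- Invertibility rests on where two equal dominoes rho / mu and rho / nu lie. Horizontal ones in row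
-- 0 come only from the entry 1, those in row k + 1 from row k; vertical ones in column 0 come only
-- from the entry -1, those in a later column from the column to its left. A horizontal domino names
-- its row, but `ver c` does not name its column; therefore `bumpV` and `minus` carry an equation on
-- `h c`, the length of the row where the new domino starts. This one number locates the new domino
-- when the rule runs forwards, and the old domino or the entry when it runs backwards.
--
-- The rule for an entry 1 or -1 makes sense only if the three known diagrams agree. Forwards this
-- is kept as an invariant: a side of a cell carries a domino exactly if a nonzero entry has already
-- been met in that row or column. Backwards the same Boolean equation, `rule-active`, forces one
-- nonzero entry in each row and column, so that bijectivity needs no counting of words or tableaux.

module Dominoes where
  open import Data.Empty using (⊥; ⊥-elim)
  open import Data.Integer using (ℤ; 0ℤ; 1ℤ; -1ℤ)
  open import Data.Nat
  open import Data.Nat.Properties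
  open import Data.Product using (_×_; _,_)
  open import Data.Sum using (_⊎_; inj₁; inj₂)
  open import Data.Unit using (⊤)
  open import Function using (_∘_; _$_)
  open import Relation.Binary.PropositionalEquality
  open import Relation.Nullary using (¬_; contradiction)

  -- Dominoes as increments of row lengths

  data Domino : Set where
    empty   : Domino
    hor ver : ℕ → Domino

  inc : Domino → ℕ → ℕ
  inc empty         _             = 0
  inc (hor zero)    zero          = 2
  inc (hor zero)    (suc _)       = 0
  inc (hor (suc k)) zero          = 0
  inc (hor (suc k)) (suc i)       = inc (hor k) i
  inc (ver zero)    zero          = 1
  inc (ver zero)    (suc zero)    = 1
  inc (ver zero)    (suc (suc _)) = 0
  inc (ver (suc k)) zero          = 0
  inc (ver (suc k)) (suc i)       = inc (ver k) i

  -- A vertical domino takes the first free cells of rows k and k + 1, and these lie in one column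
  -- exactly if the two rows have equal length.
  Flat : Domino → (ℕ → ℕ) → Set
  Flat (ver k) f = f k ≡ f (suc k)
  Flat _       _ = ⊤

  record Adds (d : Domino) (f g : ℕ → ℕ) : Set where
    constructor adds
    field
      rows : ∀ i → g i ≡ inc d i + f i
      flat : Flat d f
  open Adds

  Decreasing : (ℕ → ℕ) → Set
  Decreasing f = ∀ i → f (suc i) ≤ f i

  -- Two dominoes added to the same diagram both take the first free cell of every row they meet, so
  -- a common row already means a common cell. For removal the same holds with last cells.
  Disjoint : Domino → Domino → Set
  Disjoint d e = ∀ i → inc d i ≡ 0 ⊎ inc e i ≡ 0

  -- For diagrams lam, mu, nu, rho with row functions f, _, _, h around a cell of the growth
  -- diagram: d = nu / lam, e = mu / lam, d′ = rho / mu, e′ = rho / nu.  In bumpV and minus the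
  -- equation on h c says that ver c is the bottom of column f k + 1 and of column 0, respectively.
  data Rule (f h : ℕ → ℕ) : ℤ → (d e d′ e′ : Domino) → Set where
    disjoint : ∀ {d e} → Disjoint d e → Rule f h 0ℤ d e d e
    cornerHV : ∀ k → Rule f h 0ℤ (hor k) (ver k) (ver k) (hor (suc k))
    cornerVH : ∀ k → Rule f h 0ℤ (ver k) (hor k) (hor (suc k)) (ver k)
    bumpH    : ∀ k → Rule f h 0ℤ (hor k) (hor k) (hor (suc k)) (hor (suc k))
    bumpV    : ∀ k c → h c ≡ 2 + f k → Rule f h 0ℤ (ver k) (ver k) (ver c) (ver c)
    plus     : Rule f h 1ℤ empty empty (hor 0) (hor 0)
    minus    : ∀ c → h c ≡ 1 → Rule f h -1ℤ empty empty (ver c) (ver c)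

  private variable
    d e d′ e′ d″ e″ d₁ e₁ : Domino
    f g g′ h h′ f′ : ℕ → ℕ
    k : ℕ
    m m′ : ℤ

  hor-at : ∀ k → inc (hor k) k ≡ 2
  hor-at zero    = refl
  hor-at (suc k) = hor-at k

  hor-next : ∀ k → inc (hor k) (suc k) ≡ 0
  hor-next zero    = refl
  hor-next (suc k) = hor-next k

  hor-prev : ∀ k → inc (hor (suc k)) k ≡ 0
  hor-prev zero    = refl
  hor-prev (suc k) = hor-prev k

  ver-at : ∀ k → inc (ver k) k ≡ 1
  ver-at zero    = refl
  ver-at (suc k) = ver-at k

  ver-next : ∀ k → inc (ver k) (suc k) ≡ 1
  ver-next zero    = refl
  ver-next (suc k) = ver-next k

  ver-after : ∀ k → inc (ver k) (suc (suc k)) ≡ 0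
  ver-after zero    = refl
  ver-after (suc k) = ver-after k

  ver-below : ∀ {i k} → i < k → inc (ver k) i ≡ 0
  ver-below {zero}  (s≤s _)   = refl
  ver-below {suc i} (s≤s i<k) = ver-below i<k

  row-at : ∀ {i n} → Adds d f g → inc d i ≡ n → g i ≡ n + f i
  row-at {i = i} a eq = trans (rows a i) (cong (_+ _) eq)

  decreasing-≤ : Decreasing f → ∀ {i j} → i ≤ j → f j ≤ f i
  decreasing-≤ {f} dec i≤j = go (≤⇒≤′ i≤j)
    where
    go : ∀ {i j} → i ≤′ j → f j ≤ f i
    go ≤′-refl            = ≤-refl
    go (≤′-step {j} i≤′j) = ≤-trans (dec j) (go i≤′j)

  -- This makes the four dominoes of a `Square` functions of its diagrams, so that squares with
  -- common sides can be compared.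
  adds-unique : Adds d f g → Adds e f g → d ≡ e
  adds-unique {d} {f} {g} {e} a b = inc-injective d e λ i →
    +-cancelʳ-≡ (f i) _ _ (trans (sym (rows a i)) (rows b i))
    where
    inc-injective : ∀ d e → (∀ i → inc d i ≡ inc e i) → d ≡ e
    inc-injective empty         empty         eq = refl
    inc-injective empty         (hor k)       eq = contradiction (trans (eq k) (hor-at k)) λ ()
    inc-injective empty         (ver k)       eq = contradiction (trans (eq k) (ver-at k)) λ ()
    inc-injective (hor k)       empty         eq = contradiction (trans (sym (eq k)) (hor-at k)) λ ()
    inc-injective (ver k)       empty         eq = contradiction (trans (sym (eq k)) (ver-at k)) λ ()
    inc-injective (hor zero)    (hor zero)    eq = refl
    inc-injective (hor zero)    (hor (suc _)) eq = contradiction (eq 0) λ ()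
    inc-injective (hor (suc _)) (hor zero)    eq = contradiction (eq 0) λ ()
    inc-injective (hor (suc k)) (hor (suc l)) eq with refl ← inc-injective (hor k) (hor l) (eq ∘ suc) = refl
    inc-injective (hor zero)    (ver zero)    eq = contradiction (eq 0) λ ()
    inc-injective (hor zero)    (ver (suc _)) eq = contradiction (eq 0) λ ()
    inc-injective (hor (suc _)) (ver zero)    eq = contradiction (eq 0) λ ()
    inc-injective (hor (suc k)) (ver (suc l)) eq with () ← inc-injective (hor k) (ver l) (eq ∘ suc)
    inc-injective (ver zero)    (hor zero)    eq = contradiction (eq 0) λ ()
    inc-injective (ver zero)    (hor (suc _)) eq = contradiction (eq 0) λ ()
    inc-injective (ver (suc _)) (hor zero)    eq = contradiction (eq 0) λ ()
    inc-injective (ver (suc k)) (hor (suc l)) eq with () ← inc-injective (ver k) (hor l) (eq ∘ suc)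
    inc-injective (ver zero)    (ver zero)    eq = refl
    inc-injective (ver zero)    (ver (suc _)) eq = contradiction (eq 0) λ ()
    inc-injective (ver (suc _)) (ver zero)    eq = contradiction (eq 0) λ ()
    inc-injective (ver (suc k)) (ver (suc l)) eq with refl ← inc-injective (ver k) (ver l) (eq ∘ suc) = refl

  -- The relative positions of two dominoes, most of which are excluded when both can be
  -- added to, or both can be removed from, the same partition.
  data Position : Domino → Domino → Set where
    disjoint : Disjoint d e → Position d e
    sameH    : ∀ k → Position (hor k) (hor k)
    sameV    : ∀ k → Position (ver k) (ver k)
    topHV    : ∀ k → Position (hor k) (ver k)
    topVH    : ∀ k → Position (ver k) (hor k)
    bottomHV : ∀ k → Position (hor (suc k)) (ver k)
    bottomVH : ∀ k → Position (ver k) (hor (suc k))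
    stackVV  : ∀ k → Position (ver k) (ver (suc k))
    stackVV′ : ∀ k → Position (ver (suc k)) (ver k)

  -- Putting a new row on top moves both dominoes down; this reduces `position` to pairs in which
  -- one domino starts in row 0.
  shift : Domino → Domino
  shift empty   = empty
  shift (hor k) = hor (suc k)
  shift (ver k) = ver (suc k)

  inc-shift : ∀ d i → inc (shift d) (suc i) ≡ inc d i
  inc-shift empty   i = refl
  inc-shift (hor k) i = refl
  inc-shift (ver k) i = refl

  inc-shift-zero : ∀ d → inc (shift d) 0 ≡ 0
  inc-shift-zero empty   = refl
  inc-shift-zero (hor k) = refl
  inc-shift-zero (ver k) = refl

  shift-position : Position d e → Position (shift d) (shift e)
  shift-position {d} {e} (disjoint disj) = disjoint λ where
    zero    → inj₁ (inc-shift-zero d)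
    (suc i) → subst₂ (λ x y → x ≡ 0 ⊎ y ≡ 0) (sym (inc-shift d i)) (sym (inc-shift e i)) (disj i)
  shift-position (sameH k)    = sameH (suc k)
  shift-position (sameV k)    = sameV (suc k)
  shift-position (topHV k)    = topHV (suc k)
  shift-position (topVH k)    = topVH (suc k)
  shift-position (bottomHV k) = bottomHV (suc k)
  shift-position (bottomVH k) = bottomVH (suc k)
  shift-position (stackVV k)  = stackVV (suc k)
  shift-position (stackVV′ k) = stackVV′ (suc k)

  position : ∀ d e → Position d e
  position empty               e                   = disjoint λ _ → inj₁ refl
  position d                   empty               = disjoint λ _ → inj₂ refl
  position (hor zero)          (hor zero)          = sameH 0
  position (hor zero)          (hor (suc _))       = disjoint λ { zero → inj₂ refl ; (suc _) → inj₁ refl }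
  position (hor (suc _))       (hor zero)          = disjoint λ { zero → inj₁ refl ; (suc _) → inj₂ refl }
  position (hor (suc k))       (hor (suc l))       = shift-position (position (hor k) (hor l))
  position (hor zero)          (ver zero)          = topHV 0
  position (hor zero)          (ver (suc _))       = disjoint λ { zero → inj₂ refl ; (suc _) → inj₁ refl }
  position (hor (suc zero))    (ver zero)          = bottomHV 0
  position (hor (suc (suc _))) (ver zero)          =
    disjoint λ { zero → inj₁ refl ; (suc zero) → inj₁ refl ; (suc (suc _)) → inj₂ refl }
  position (hor (suc k))       (ver (suc l))       = shift-position (position (hor k) (ver l))
  position (ver zero)          (hor zero)          = topVH 0
  position (ver (suc _))       (hor zero)          = disjoint λ { zero → inj₁ refl ; (suc _) → inj₂ refl }
  position (ver zero)          (hor (suc zero))    = bottomVH 0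
  position (ver zero)          (hor (suc (suc _))) =
    disjoint λ { zero → inj₂ refl ; (suc zero) → inj₂ refl ; (suc (suc _)) → inj₁ refl }
  position (ver (suc k))       (hor (suc l))       = shift-position (position (ver k) (hor l))
  position (ver zero)          (ver zero)          = sameV 0
  position (ver zero)          (ver (suc zero))    = stackVV 0
  position (ver (suc zero))    (ver zero)          = stackVV′ 0
  position (ver zero)          (ver (suc (suc _))) =
    disjoint λ { zero → inj₂ refl ; (suc zero) → inj₂ refl ; (suc (suc _)) → inj₁ refl }
  position (ver (suc (suc _))) (ver zero)          =
    disjoint λ { zero → inj₁ refl ; (suc zero) → inj₁ refl ; (suc (suc _)) → inj₂ refl }
  position (ver (suc k))       (ver (suc l))       = shift-position (position (ver k) (ver l))

  -- Which relative positions can occur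

  disjoint-sym : Disjoint d e → Disjoint e d
  disjoint-sym disj i with disj i
  ... | inj₁ p = inj₂ p
  ... | inj₂ p = inj₁ p

  ¬disjoint-hor : ∀ k → ¬ Disjoint (hor k) (hor k)
  ¬disjoint-hor k disj with disj k
  ... | inj₁ p = contradiction (trans (sym p) (hor-at k)) λ ()
  ... | inj₂ p = contradiction (trans (sym p) (hor-at k)) λ ()

  ¬disjoint-ver : ∀ k → ¬ Disjoint (ver k) (ver k)
  ¬disjoint-ver k disj with disj k
  ... | inj₁ p = contradiction (trans (sym p) (ver-at k)) λ ()
  ... | inj₂ p = contradiction (trans (sym p) (ver-at k)) λ ()

  ¬disjoint-topHV : ∀ k → ¬ Disjoint (hor k) (ver k)
  ¬disjoint-topHV k disj with disj k
  ... | inj₁ p = contradiction (trans (sym p) (hor-at k)) λ ()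
  ... | inj₂ p = contradiction (trans (sym p) (ver-at k)) λ ()

  ¬disjoint-topVH : ∀ k → ¬ Disjoint (ver k) (hor k)
  ¬disjoint-topVH k disj with disj k
  ... | inj₁ p = contradiction (trans (sym p) (ver-at k)) λ ()
  ... | inj₂ p = contradiction (trans (sym p) (hor-at k)) λ ()

  -- Rows k and k + 1 are level, so the lower one cannot grow alone. With `¬add-stack`, distinct
  -- overlapping dominoes added to one partition can meet only as `topHV` or `topVH`.
  ¬add-bottom : Decreasing g → f k ≡ f (suc k) → Adds (hor (suc k)) f g → ⊥
  ¬add-bottom {g} {f} {k} dec eq a = <⇒≱ (s≤s (n≤1+n (f k))) $ begin
    2 + f k       ≡⟨ cong (2 +_) eq ⟩
    2 + f (suc k) ≡⟨ row-at a (hor-at (suc k)) ⟨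
    g (suc k)     ≤⟨ dec k ⟩
    g k           ≡⟨ row-at a (hor-prev k) ⟩
    f k           ∎
    where open ≤-Reasoning

  ¬add-stack : Decreasing g → f k ≡ f (suc k) → Adds (ver (suc k)) f g → ⊥
  ¬add-stack {g} {f} {k} dec eq a = <⇒≱ (n<1+n (f k)) $ begin
    1 + f k       ≡⟨ cong (1 +_) eq ⟩
    1 + f (suc k) ≡⟨ row-at a (ver-at (suc k)) ⟨
    g (suc k)     ≤⟨ dec k ⟩
    g k           ≡⟨ row-at a (ver-below (n<1+n k)) ⟩
    f k           ∎
    where open ≤-Reasoning

  ver-flat′ : Adds (ver k) f g → g k ≡ g (suc k)
  ver-flat′ {k} a = trans (row-at a (ver-at k)) (trans (cong suc (flat a)) (sym (row-at a (ver-next k))))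

  -- Dually, the upper of two level rows cannot shrink alone. With `¬remove-stack`, distinct
  -- overlapping dominoes removed from one partition can meet only as `bottomHV` or `bottomVH`.
  ¬remove-top : Decreasing f → g k ≡ g (suc k) → Adds (hor k) f g → ⊥
  ¬remove-top {f} {g} {k} dec eq a = <⇒≱ (s≤s (n≤1+n (f k))) $ begin
    2 + f k   ≡⟨ row-at a (hor-at k) ⟨
    g k       ≡⟨ eq ⟩
    g (suc k) ≡⟨ row-at a (hor-next k) ⟩
    f (suc k) ≤⟨ dec k ⟩
    f k       ∎
    where open ≤-Reasoning

  ¬remove-stack : Decreasing f → g (suc k) ≡ g (suc (suc k)) → Adds (ver k) f g → ⊥
  ¬remove-stack {f} {g} {k} dec eq a = <⇒≱ (n<1+n (f (suc k))) $ begin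
    1 + f (suc k)   ≡⟨ row-at a (ver-next k) ⟨
    g (suc k)       ≡⟨ eq ⟩
    g (suc (suc k)) ≡⟨ row-at a (ver-after k) ⟩
    f (suc (suc k)) ≤⟨ dec (suc k) ⟩
    f (suc k)       ∎
    where open ≤-Reasoning

  -- If c < c′, then row c grows in h but not in h′, although row c of h′ must be at least as long
  -- as row c′ of h′, that is, as row c of h.
  ver-bottom-≮ : Decreasing h′ → ∀ {c c′} → Adds (ver c) g h → Adds (ver c′) g h′ → h c ≡ h′ c′ → ¬ c < c′
  ver-bottom-≮ {h′} {g} {h} dec {c} {c′} a a′ eq c<c′ = <⇒≱ (n<1+n (g c)) $ begin
    1 + g c ≡⟨ row-at a (ver-at c) ⟨
    h c     ≡⟨ eq ⟩
    h′ c′   ≤⟨ decreasing-≤ dec (<⇒≤ c<c′) ⟩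
    h′ c    ≡⟨ row-at a′ (ver-below c<c′) ⟩
    g c     ∎
    where open ≤-Reasoning

  ver-bottom-unique : Decreasing h → Decreasing h′ → ∀ {c c′} →
                      Adds (ver c) g h → Adds (ver c′) g h′ → h c ≡ h′ c′ → c ≡ c′
  ver-bottom-unique dec dec′ a a′ eq =
    ≤-antisym (≮⇒≥ (ver-bottom-≮ dec a′ a (sym eq))) (≮⇒≥ (ver-bottom-≮ dec′ a a′ eq))

  -- The hypothesis puts both dominoes in one column of g. The domino at k is the bottom of that
  -- column, because row k + 2 of g is still short, and the domino at k′ > k would need a cell below
  -- it.
  ver-top-≮ : Decreasing f → Decreasing g → ∀ {k k′} → Adds (ver k) f g → Adds (ver k′) f′ g → f k ≡ f′ k′ → ¬ k < k′
  ver-top-≮ {f} {g} {f′} decf dec {k} {k′} a a′ eq k<k′ = <⇒≱ (n<1+n (f k)) $ begin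
    1 + f k         ≡⟨ cong (1 +_) (trans eq (flat a′)) ⟩
    1 + f′ (suc k′) ≡⟨ row-at a′ (ver-next k′) ⟨
    g (suc k′)      ≤⟨ decreasing-≤ dec (s≤s k<k′) ⟩
    g (suc (suc k)) ≡⟨ row-at a (ver-after k) ⟩
    f (suc (suc k)) ≤⟨ decf (suc k) ⟩
    f (suc k)       ≡⟨ flat a ⟨
    f k             ∎
    where open ≤-Reasoning

  ver-top-unique : Decreasing f → Decreasing f′ → Decreasing g → ∀ {k k′} →
                   Adds (ver k) f g → Adds (ver k′) f′ g → f k ≡ f′ k′ → k ≡ k′
  ver-top-unique decf decf′ dec a a′ eq =
    ≤-antisym (≮⇒≥ (ver-top-≮ decf′ dec a′ a (sym eq))) (≮⇒≥ (ver-top-≮ decf dec a a′ eq))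

  -- Determinism of the local rule in both directions

  record Square (m : ℤ) (f u v h : ℕ → ℕ) : Set where
    field
      {top left bottom right} : Domino
      top-adds    : Adds top f v
      left-adds   : Adds left f u
      bottom-adds : Adds bottom u h
      right-adds  : Adds right v h
      rule        : Rule f h m top left bottom right
  open Square

  -- `disjoint` is incompatible with the other cases of entry 0, where d and e share row k. Within
  -- one case only `bumpV` and `minus` leave a parameter open, the row c, and their equation fixes
  -- it. Comparing d′ is enough, since h is u increased by d′.
  rule-deterministic : ∀ {u v} → Decreasing h → Decreasing h′ →
    Adds d f v → Adds e f u → Adds d′ u h → Adds d″ u h′ →
    Rule f h m d e d′ e′ → Rule f h′ m d e d″ e″ → d′ ≡ d″
  rule-deterministic _ _ _ _ _ _ (disjoint _)    (disjoint _)     = refl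
  rule-deterministic _ _ _ _ _ _ (disjoint disj) (cornerHV k)     = ⊥-elim (¬disjoint-topHV k disj)
  rule-deterministic _ _ _ _ _ _ (disjoint disj) (cornerVH k)     = ⊥-elim (¬disjoint-topVH k disj)
  rule-deterministic _ _ _ _ _ _ (disjoint disj) (bumpH k)        = ⊥-elim (¬disjoint-hor k disj)
  rule-deterministic _ _ _ _ _ _ (disjoint disj) (bumpV k _ _)    = ⊥-elim (¬disjoint-ver k disj)
  rule-deterministic _ _ _ _ _ _ (cornerHV k)    (disjoint disj)  = ⊥-elim (¬disjoint-topHV k disj)
  rule-deterministic _ _ _ _ _ _ (cornerVH k)    (disjoint disj)  = ⊥-elim (¬disjoint-topVH k disj)
  rule-deterministic _ _ _ _ _ _ (bumpH k)       (disjoint disj)  = ⊥-elim (¬disjoint-hor k disj)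
  rule-deterministic _ _ _ _ _ _ (bumpV k _ _)   (disjoint disj)  = ⊥-elim (¬disjoint-ver k disj)
  rule-deterministic _ _ _ _ _ _ (cornerHV _)    (cornerHV _)     = refl
  rule-deterministic _ _ _ _ _ _ (cornerVH _)    (cornerVH _)     = refl
  rule-deterministic _ _ _ _ _ _ (bumpH _)       (bumpH _)        = refl
  rule-deterministic dec dec′ _ _ a a′ (bumpV _ _ eq) (bumpV _ _ eq′) =
    cong ver (ver-bottom-unique dec dec′ a a′ (trans eq (sym eq′)))
  rule-deterministic _ _ _ _ _ _ plus            plus             = refl
  rule-deterministic dec dec′ _ _ a a′ (minus _ eq) (minus _ eq′)  =
    cong ver (ver-bottom-unique dec dec′ a a′ (trans eq (sym eq′)))

  square-deterministic : ∀ {u v} → Decreasing h → Decreasing h′ →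
    Square m f u v h → Square m f u v h′ → ∀ i → h i ≡ h′ i
  square-deterministic dec dec′ s s′ i
    with refl ← adds-unique (top-adds s) (top-adds s′)
    with refl ← adds-unique (left-adds s) (left-adds s′)
    with refl ← rule-deterministic dec dec′ (top-adds s) (left-adds s) (bottom-adds s) (bottom-adds s′) (rule s) (rule s′)
    = trans (rows (bottom-adds s) i) (sym (rows (bottom-adds s′) i))

  -- The row index separates `plus` from `bumpH`, and `h c` being 1 or at least 2 separates `minus`
  -- from `bumpV`. A corner and a `disjoint` pair with the same outcome would put a horizontal
  -- domino under level rows. For two `bumpV`, the common `h c` says that the old dominoes share a
  -- column, of which both are the bottom.
  rule-injective : ∀ {u v} → Decreasing f → Decreasing f′ → Decreasing u → Decreasing v →
    Adds d f v → Adds e f u → Adds d₁ f′ v → Adds e₁ f′ u →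
    Rule f h m d e d′ e′ → Rule f′ h m′ d₁ e₁ d′ e′ → m ≡ m′ × d ≡ d₁
  rule-injective _ _ _ _ _ _ _ _ (disjoint _)    (disjoint _)    = refl , refl
  rule-injective _ _ du _ a b _ _ (disjoint _)   (cornerHV k)    = ⊥-elim (¬add-bottom du (flat a) b)
  rule-injective _ _ _ dv a b _ _ (disjoint _)   (cornerVH k)    = ⊥-elim (¬add-bottom dv (flat b) a)
  rule-injective _ _ _ _ _ _ _ _ (disjoint disj) (bumpH k)       = ⊥-elim (¬disjoint-hor (suc k) disj)
  rule-injective _ _ _ _ _ _ _ _ (disjoint disj) (bumpV _ c _)   = ⊥-elim (¬disjoint-ver c disj)
  rule-injective _ _ _ _ _ _ _ _ (disjoint disj) plus            = ⊥-elim (¬disjoint-hor 0 disj)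
  rule-injective _ _ _ _ _ _ _ _ (disjoint disj) (minus c _)     = ⊥-elim (¬disjoint-ver c disj)
  rule-injective _ _ du _ _ _ a b (cornerHV k)    (disjoint _)    = ⊥-elim (¬add-bottom du (flat a) b)
  rule-injective _ _ _ dv _ _ a b (cornerVH k)    (disjoint _)    = ⊥-elim (¬add-bottom dv (flat b) a)
  rule-injective _ _ _ _ _ _ _ _ (bumpH k)       (disjoint disj) = ⊥-elim (¬disjoint-hor (suc k) disj)
  rule-injective _ _ _ _ _ _ _ _ (bumpV _ c _)   (disjoint disj) = ⊥-elim (¬disjoint-ver c disj)
  rule-injective _ _ _ _ _ _ _ _ plus            (disjoint disj) = ⊥-elim (¬disjoint-hor 0 disj)
  rule-injective _ _ _ _ _ _ _ _ (minus c _)     (disjoint disj) = ⊥-elim (¬disjoint-ver c disj)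
  rule-injective _ _ _ _ _ _ _ _ (cornerHV _)    (cornerHV _)    = refl , refl
  rule-injective _ _ _ _ _ _ _ _ (cornerVH _)    (cornerVH _)    = refl , refl
  rule-injective _ _ _ _ _ _ _ _ (bumpH _)       (bumpH _)       = refl , refl
  rule-injective df df′ _ dv a _ a′ _ (bumpV _ _ eq) (bumpV _ _ eq′) =
    refl , cong ver (ver-top-unique df df′ dv a a′ (suc-injective (suc-injective (trans (sym eq) eq′))))
  rule-injective _ _ _ _ _ _ _ _ (bumpV _ _ eq)  (minus _ eq′)   with () ← trans (sym eq) eq′
  rule-injective _ _ _ _ _ _ _ _ (minus _ eq)    (bumpV _ _ eq′)  with () ← trans (sym eq) eq′
  rule-injective _ _ _ _ _ _ _ _ plus            plus            = refl , refl
  rule-injective _ _ _ _ _ _ _ _ (minus _ _)     (minus _ _)     = refl , refl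

  square-injective : ∀ {u v} → Decreasing f → Decreasing f′ → Decreasing u → Decreasing v →
    Square m f u v h → Square m′ f′ u v h → m ≡ m′ × (∀ i → f i ≡ f′ i)
  square-injective df df′ du dv s s′
    with refl ← adds-unique (bottom-adds s) (bottom-adds s′)
    with refl ← adds-unique (right-adds s) (right-adds s′)
    with refl , refl ← rule-injective df df′ du dv (top-adds s) (left-adds s) (top-adds s′) (left-adds s′) (rule s) (rule s′)
    = refl , λ i → +-cancelˡ-≡ (inc (top s) i) _ _ (trans (sym (rows (top-adds s) i)) (rows (top-adds s′) i))

module DominoGrowth where
  open import Data.Bool using (Bool; true; false; not; _∨_)
  open import Data.Bool.Properties using (∨-identityʳ; ∨-zeroʳ)
  open import Data.Empty using (⊥-elim)
  open import Data.Fin using (Fin; toℕ; fromℕ<; fromℕ; inject₁; opposite) renaming (zero to fzero; suc to fsuc)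
  import Data.Fin.Properties as Fin
  import Data.Integer as ℤ
  open import Data.Integer using (ℤ; -[1+_]; 0ℤ; 1ℤ; -1ℤ)
  import Data.Integer.Properties as ℤ
  import Data.Integer.Solver as ℤ
  open import Data.List using (List; []; _∷_; _++_; applyUpTo; concatMap; drop; length; upTo)
  import Data.List.Membership.DecPropositional as DecMembership
  open import Data.List.Membership.Propositional using () renaming (_∈_ to _∈ₗ_)
  open import Data.List.Membership.Propositional.Properties
    using (∈-concatMap⁺; ∈-concatMap⁻; ∈-applyUpTo⁺; ∈-applyUpTo⁻; ∈-upTo⁺)
  open import Data.List.Properties using (filter-accept; filter-all; filter-none; filter-reject; ++-identityʳ)
  open import Data.List.Relation.Unary.All as All using (All; []; _∷_)
  open import Data.List.Relation.Unary.Any as Any using (here; there; satisfied)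
  open import Data.List.Relation.Unary.Linked using (Linked; []; [-]; _∷_)
  open import Data.Nat
  open import Data.Nat.ListAction using (sum)
  open import Data.Nat.Properties
  open import Data.Nat.Solver using (module +-*-Solver)
  open import Data.Product using (∃; ∃₂; _×_; _,_; proj₁; proj₂)
  import Data.Rational as ℚ
  import Data.Rational.Properties as ℚ
  import Data.Rational.Unnormalised as ℚᵘ
  import Data.Rational.Unnormalised.Properties as ℚᵘ
  open import Data.Sum using (inj₁; inj₂)
  open import Data.Unit using (⊤; tt)
  open import Data.Vec using (Vec; countᵇ; lookup; tabulate)
  open import Data.Vec.Properties using (lookup∘tabulate; tabulate∘lookup; tabulate-cong)
  open import Function using (_∘_; id; case_of_)
  open import Relation.Binary.Construct.Closure.ReflexiveTransitive using (Star; ε; _◅_)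
  open import Relation.Binary.PropositionalEquality
  open import Relation.Nullary using (¬_; contradiction; contradiction-irr; yes; no; does)
  open import Relation.Nullary.Decidable using (dec-true; dec-false)
  open import Relation.Unary using (_∈_)
  open Dominoes
  open Adds
  open Square
  open DecMembership _≟ᶜ_ using (_∈?_)

  -- Diagrams and their rows

  Positive : Diagram → Set
  Positive = All (0 <_)

  linked⇒decreasing : ∀ {lam} → Linked _≥_ lam → Decreasing (row lam)
  linked⇒decreasing []        i       = z≤n
  linked⇒decreasing [-]       zero    = z≤n
  linked⇒decreasing [-]       (suc i) = z≤n
  linked⇒decreasing (p ∷ _)   zero    = p
  linked⇒decreasing (_ ∷ ps)  (suc i) = linked⇒decreasing ps i

  decreasing⇒linked : ∀ lam → Decreasing (row lam) → Linked _≥_ lam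
  decreasing⇒linked []            _   = []
  decreasing⇒linked (x ∷ [])      _   = [-]
  decreasing⇒linked (x ∷ y ∷ lam) dec = dec 0 ∷ decreasing⇒linked (y ∷ lam) (dec ∘ suc)

  decreasing : ∀ {lam} → IsPartition lam → Decreasing (row lam)
  decreasing (linked , _) = linked⇒decreasing linked

  -- Two lists with the same rows can differ only by trailing zeros, which positivity excludes.
  positive-ext : ∀ {lam mu} → Positive lam → Positive mu → (∀ i → row lam i ≡ row mu i) → lam ≡ mu
  positive-ext []       []       eq = refl
  positive-ext []       (q ∷ _)  eq = contradiction (eq 0) (<⇒≢ q)
  positive-ext (p ∷ _)  []       eq = contradiction (sym (eq 0)) (<⇒≢ p)
  positive-ext (p ∷ ps) (q ∷ qs) eq = cong₂ _∷_ (eq 0) (positive-ext ps qs (eq ∘ suc))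

  partition-ext : ∀ {lam mu} → IsPartition lam → IsPartition mu → (∀ i → row lam i ≡ row mu i) → lam ≡ mu
  partition-ext (_ , p) (_ , q) = positive-ext p q

  row-support : ∀ lam i → 0 < row lam i → i < length lam
  row-support (x ∷ lam) zero    p = z<s
  row-support (x ∷ lam) (suc i) p = s<s (row-support lam i p)

  row-beyond : ∀ lam → row lam (length lam) ≡ 0
  row-beyond []        = refl
  row-beyond (x ∷ lam) = row-beyond lam

  -- Cutting at the first zero row, rather than at n, keeps the list free of zeros.
  fromRows : (ℕ → ℕ) → ℕ → Diagram
  fromRows f zero    = []
  fromRows f (suc n) with f 0
  ... | zero  = []
  ... | suc x = suc x ∷ fromRows (f ∘ suc) n

  row-fromRows : ∀ {f n} → Decreasing f → f n ≡ 0 → ∀ i → row (fromRows f n) i ≡ f i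
  row-fromRows {f} {zero}  dec eq i = sym (n≤0⇒n≡0 (≤-trans (decreasing-≤ dec z≤n) (≤-reflexive eq)))
  row-fromRows {f} {suc n} dec eq i with f 0 in eq₀
  row-fromRows {f} {suc n} dec eq i       | zero  = sym (n≤0⇒n≡0 (≤-trans (decreasing-≤ dec z≤n) (≤-reflexive eq₀)))
  row-fromRows {f} {suc n} dec eq zero    | suc x = sym eq₀
  row-fromRows {f} {suc n} dec eq (suc i) | suc x = row-fromRows (dec ∘ suc) eq i

  fromRows-positive : ∀ f n → Positive (fromRows f n)
  fromRows-positive f zero    = []
  fromRows-positive f (suc n) with f 0
  ... | zero  = []
  ... | suc x = z<s ∷ fromRows-positive (f ∘ suc) n

  partition-of : ∀ f n → Decreasing f → f n ≡ 0 → ∃ λ lam → IsPartition lam × ∀ i → row lam i ≡ f i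
  partition-of f n dec eq =
      fromRows f n
    , (decreasing⇒linked _ (λ i → subst₂ _≤_ (sym (rows≡ (suc i))) (sym (rows≡ i)) (dec i)) , fromRows-positive f n)
    , rows≡
    where rows≡ = row-fromRows dec eq

  row-∪ : ∀ lam mu i → row (lam ∪ mu) i ≡ row lam i ⊔ row mu i
  row-∪ []        mu       i       = refl
  row-∪ (x ∷ lam) []       i       = sym (⊔-identityʳ _)
  row-∪ (x ∷ lam) (y ∷ mu) zero    = refl
  row-∪ (x ∷ lam) (y ∷ mu) (suc i) = row-∪ lam mu i

  ∪-positive : ∀ {lam mu} → Positive lam → Positive mu → Positive (lam ∪ mu)
  ∪-positive []       qs       = qs
  ∪-positive (p ∷ ps) []       = p ∷ ps
  ∪-positive (p ∷ ps) (q ∷ qs) = ≤-trans p (m≤m⊔n _ _) ∷ ∪-positive ps qs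

  row-addCell-≥ : ∀ k l lam i → row lam i ≤ row (addCell (k , l) lam) i
  row-addCell-≥ zero    l []        i       = z≤n
  row-addCell-≥ zero    l (x ∷ lam) zero    = m≤m⊔n x (suc l)
  row-addCell-≥ zero    l (x ∷ lam) (suc i) = ≤-refl
  row-addCell-≥ (suc k) l []        i       = z≤n
  row-addCell-≥ (suc k) l (x ∷ lam) zero    = ≤-refl
  row-addCell-≥ (suc k) l (x ∷ lam) (suc i) = row-addCell-≥ k l lam i

  row-addCell-at : ∀ k l lam → row (addCell (k , l) lam) k ≡ row lam k ⊔ suc l
  row-addCell-at zero    l []        = refl
  row-addCell-at zero    l (x ∷ lam) = refl
  row-addCell-at (suc k) l []        = row-addCell-at k l []
  row-addCell-at (suc k) l (x ∷ lam) = row-addCell-at k l lam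

  row-addCell-off : ∀ k l lam {i} → i ≢ k → row (addCell (k , l) lam) i ≡ row lam i
  row-addCell-off zero    l []        {zero}  i≢k = contradiction refl i≢k
  row-addCell-off zero    l []        {suc i} i≢k = refl
  row-addCell-off zero    l (x ∷ lam) {zero}  i≢k = contradiction refl i≢k
  row-addCell-off zero    l (x ∷ lam) {suc i} i≢k = refl
  row-addCell-off (suc k) l []        {zero}  i≢k = refl
  row-addCell-off (suc k) l []        {suc i} i≢k = row-addCell-off k l [] (i≢k ∘ cong suc)
  row-addCell-off (suc k) l (x ∷ lam) {zero}  i≢k = refl
  row-addCell-off (suc k) l (x ∷ lam) {suc i} i≢k = row-addCell-off k l lam (i≢k ∘ cong suc)

  -- `addCell` pads skipped rows with zeros, so the rows above the new cell must already be
  -- occupied.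
  addCell-positive : ∀ k l {lam} → Positive lam → (∀ {i} → i < k → 0 < row lam i) → Positive (addCell (k , l) lam)
  addCell-positive zero    l []       above = z<s ∷ []
  addCell-positive zero    l (p ∷ ps) above = ≤-trans p (m≤m⊔n _ _) ∷ ps
  addCell-positive (suc k) l []       above with () ← above {0} z<s
  addCell-positive (suc k) l (p ∷ ps) above = p ∷ addCell-positive k l ps (above ∘ s<s)

  appendTwoToRow-adds : ∀ k lam → Adds (hor k) (row lam) (row (appendTwoToRow k lam))
  appendTwoToRow-adds k lam = adds (go k lam) tt
    where
    go : ∀ k lam i → row (appendTwoToRow k lam) i ≡ inc (hor k) i + row lam i
    go zero    []        zero    = refl
    go zero    []        (suc i) = refl
    go zero    (x ∷ lam) zero    =
      trans (cong (_⊔ (2 + x)) (m≤n⇒m⊔n≡n (n≤1+n x))) (m≤n⇒m⊔n≡n (n≤1+n (1 + x)))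
    go zero    (x ∷ lam) (suc i) = refl
    go (suc k) []        zero    = refl
    go (suc k) []        (suc i) = go k [] i
    go (suc k) (x ∷ lam) zero    = refl
    go (suc k) (x ∷ lam) (suc i) = go k lam i

  addTwoVertically-adds : ∀ c {l} lam → row lam c ≡ l → row lam (suc c) ≡ l →
                          Adds (ver c) (row lam) (row (addCell (suc c , l) (addCell (c , l) lam)))
  addTwoVertically-adds c lam eq eq′ = adds (go c lam eq eq′) (trans eq (sym eq′))
    where
    go : ∀ c {l} lam → row lam c ≡ l → row lam (suc c) ≡ l →
         ∀ i → row (addCell (suc c , l) (addCell (c , l) lam)) i ≡ inc (ver c) i + row lam i
    go zero    []            refl eq′  zero          = refl
    go zero    []            refl eq′  (suc zero)    = refl
    go zero    []            refl eq′  (suc (suc i)) = refl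
    go zero    (x ∷ [])      refl refl zero          = refl
    go zero    (x ∷ [])      refl refl (suc zero)    = refl
    go zero    (x ∷ [])      refl refl (suc (suc i)) = refl
    go zero    (x ∷ y ∷ lam) refl refl zero          = m≤n⇒m⊔n≡n (n≤1+n x)
    go zero    (x ∷ y ∷ lam) refl refl (suc zero)    = m≤n⇒m⊔n≡n (n≤1+n x)
    go zero    (x ∷ y ∷ lam) refl refl (suc (suc i)) = refl
    go (suc c) []            refl eq′  zero          = refl
    go (suc c) []            refl eq′  (suc i)       = go c [] refl eq′ i
    go (suc c) (x ∷ lam)     eq   eq′  zero          = refl
    go (suc c) (x ∷ lam)     eq   eq′  (suc i)       = go c lam eq eq′ i

  -- `col` counts the rows longer than l, and in a decreasing list these are the first ones. With
  -- `row⇒col` this is conjugation of partitions, cell by cell.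
  col⇒row : ∀ lam {l} → Decreasing (row lam) → ∀ {k} → k < col lam l → l < row lam k
  col⇒row (x ∷ lam) {l} dec {k} k<col with l <? x
  col⇒row (x ∷ lam) {l} dec {zero}  k<col | yes l<x = l<x
  col⇒row (x ∷ lam) {l} dec {suc k} k<col | yes l<x =
    col⇒row lam (dec ∘ suc) (s<s⁻¹ (subst ((suc k <_) ∘ length) (filter-accept (l <?_) l<x) k<col))
  col⇒row (x ∷ lam) {l} dec {k}     k<col | no l≮x  = contradiction
    (<-≤-trans (col⇒row lam (dec ∘ suc) (subst ((k <_) ∘ length) (filter-reject (l <?_) l≮x) k<col))
               (decreasing-≤ dec {0} {suc k} z≤n)) l≮x

  row⇒col : ∀ lam {l} → Decreasing (row lam) → ∀ {k} → l < row lam k → k < col lam l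
  row⇒col (x ∷ lam) {l} dec {k} l<row with l <? x
  row⇒col (x ∷ lam) {l} dec {zero}  l<row | yes l<x =
    subst ((0 <_) ∘ length) (sym (filter-accept (l <?_) l<x)) z<s
  row⇒col (x ∷ lam) {l} dec {suc k} l<row | yes l<x =
    subst ((suc k <_) ∘ length) (sym (filter-accept (l <?_) l<x)) (s<s (row⇒col lam (dec ∘ suc) l<row))
  row⇒col (x ∷ lam) {l} dec {k}     l<row | no l≮x  =
    contradiction (<-≤-trans l<row (decreasing-≤ dec {0} {k} z≤n)) l≮x

  -- Lists of cells versus increments

  cells : Domino → (ℕ → ℕ) → List Cell
  cells empty   f = []
  cells (hor k) f = (k , f k) ∷ (k , suc (f k)) ∷ []
  cells (ver k) f = (k , f k) ∷ (suc k , f k) ∷ []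

  -- In the row-by-row listing of a skew shape that is a domino, all blocks are empty but one
  -- (horizontal) or two adjacent ones (vertical).
  concatMap-single : ∀ {A B : Set} (g : A → List B) h n k → k < n →
    (∀ i → i ≢ k → g (h i) ≡ []) → concatMap g (applyUpTo h n) ≡ g (h k)
  concatMap-single {A} {B} g h (suc n) zero    k<n     off =
    trans (cong₂ _++_ refl (all-empty (h ∘ suc) n λ i → off (suc i) λ ())) (++-identityʳ _)
    where
    all-empty : ∀ h n → (∀ i → g (h i) ≡ []) → concatMap g (applyUpTo h n) ≡ []
    all-empty h zero    off = refl
    all-empty h (suc n) off = cong₂ _++_ (off 0) (all-empty (h ∘ suc) n (off ∘ suc))
  concatMap-single g h (suc n) (suc k) (s≤s k<n) off =
    cong₂ _++_ (off 0 λ ()) (concatMap-single g (h ∘ suc) n k k<n λ i i≢k → off (suc i) (i≢k ∘ suc-injective))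

  concatMap-pair : ∀ {A B : Set} (g : A → List B) h n k → suc k < n →
    (∀ i → i ≢ k → i ≢ suc k → g (h i) ≡ []) → concatMap g (applyUpTo h n) ≡ g (h k) ++ g (h (suc k))
  concatMap-pair g h (suc n) zero    (s≤s k<n) off =
    cong₂ _++_ refl (concatMap-single g (h ∘ suc) n 0 k<n λ i i≢0 → off (suc i) (λ ()) (i≢0 ∘ suc-injective))
  concatMap-pair g h (suc n) (suc k) (s≤s k<n) off =
    cong₂ _++_ (off 0 (λ ()) λ ())
          (concatMap-pair g (h ∘ suc) n k k<n λ i p q → off (suc i) (p ∘ suc-injective) (q ∘ suc-injective))

  concatMap-empty : ∀ {A B : Set} (g : A → List B) xs → (∀ x → g x ≡ []) → concatMap g xs ≡ []
  concatMap-empty g []       off = refl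
  concatMap-empty g (x ∷ xs) off = cong₂ _++_ (off x) (concatMap-empty g xs off)

  hor-off : ∀ {k i} → i ≢ k → inc (hor k) i ≡ 0
  hor-off {zero}  {zero}  i≢k = contradiction refl i≢k
  hor-off {zero}  {suc i} i≢k = refl
  hor-off {suc k} {zero}  i≢k = refl
  hor-off {suc k} {suc i} i≢k = hor-off {k} {i} (i≢k ∘ cong suc)

  ver-off : ∀ {k i} → i ≢ k → i ≢ suc k → inc (ver k) i ≡ 0
  ver-off {zero}  {zero}        p q = contradiction refl p
  ver-off {zero}  {suc zero}    p q = contradiction refl q
  ver-off {zero}  {suc (suc i)} p q = refl
  ver-off {suc k} {zero}        p q = refl
  ver-off {suc k} {suc i}       p q = ver-off {k} {i} (p ∘ cong suc) (q ∘ cong suc)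

  ∖-cells : ∀ {d lam mu} → Adds d (row lam) (row mu) → mu ∖ lam ≡ cells d (row lam)
  ∖-cells {d} {lam} {mu} a = go d refl
    where
    fill : ℕ → List Cell
    fill k = applyUpTo (λ t → k , row lam k + t) (row mu k ∸ row lam k)

    fill-inc : ∀ {k n} → inc d k ≡ n → fill k ≡ applyUpTo (λ t → k , row lam k + t) n
    fill-inc {k} eq = cong (applyUpTo _)
      (trans (cong (_∸ row lam k) (row-at {f = row lam} {g = row mu} a eq)) (m+n∸n≡m _ (row lam k)))

    support : ∀ {i n} → inc d i ≡ suc n → i < length mu
    support {i} eq = row-support mu i (subst (0 <_) (sym (row-at a eq)) z<s)

    go : ∀ d′ → d ≡ d′ → concatMap fill (upTo (length mu)) ≡ cells d′ (row lam)
    go empty   refl = concatMap-empty fill (upTo (length mu)) λ _ → fill-inc refl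
    go (hor k) refl =
      trans (concatMap-single fill id (length mu) k (support (hor-at k)) λ i i≢k → fill-inc (hor-off i≢k))
      (trans (fill-inc (hor-at k))
      (cong₂ (λ x y → (k , x) ∷ (k , y) ∷ []) (+-identityʳ _) (+-comm _ 1)))
    go (ver k) refl =
      trans (concatMap-pair fill id (length mu) k (support (ver-next k)) λ i p q → fill-inc (ver-off p q))
      (trans (cong₂ _++_ (fill-inc (ver-at k)) (fill-inc (ver-next k)))
      (cong₂ (λ x y → (k , x) ∷ (suc k , y) ∷ []) (+-identityʳ _) (trans (+-identityʳ _) (sym (flat a)))))

  active : Domino → Bool
  active empty = false
  active _     = true

  vertical? : Domino → Bool
  vertical? (ver _) = true
  vertical? _       = false

  isVertical-cells : ∀ d f → isVertical (cells d f) ≡ vertical? d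
  isVertical-cells empty   f = refl
  isVertical-cells (hor k) f = dec-false (f k ≟ suc (f k)) (1+n≢n ∘ sym)
  isVertical-cells (ver k) f = dec-true (f k ≟ f k) refl

  adds⇒⊆ : ∀ {d lam mu} → Adds d (row lam) (row mu) → lam ⊆ mu
  adds⇒⊆ {d} {lam} a k = subst (row lam k ≤_) (sym (rows a k)) (m≤n+m (row lam k) (inc d k))

  adds⇒⋖ : ∀ {d lam mu} → active d ≡ true → Adds d (row lam) (row mu) → lam ⋖ mu
  adds⇒⋖ {d} {lam} {mu} act a = adds⇒⊆ {d} {lam} {mu} a , subst IsDomino (sym (∖-cells {d} {lam} {mu} a)) (domino d act)
    where
    domino : ∀ d → active d ≡ true → IsDomino (cells d (row lam))
    domino (hor k) _ = horizontal k _
    domino (ver k) _ = vertical k _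

  ∈-∖⁺ : ∀ lam mu {k l} → row lam k ≤ l → l < row mu k → (k , l) ∈ₗ mu ∖ lam
  ∈-∖⁺ lam mu {k} {l} ≤l l< = ∈-concatMap⁺ fill
    (Any.map (λ { refl → subst (λ x → (k , x) ∈ₗ fill k) (m+[n∸m]≡n ≤l) (∈-applyUpTo⁺ _ (∸-monoˡ-< l< ≤l)) })
             (∈-upTo⁺ (row-support mu k (≤-<-trans z≤n l<))))
    where
    fill : ℕ → List Cell
    fill k = applyUpTo (λ t → k , row lam k + t) (row mu k ∸ row lam k)

  ∈-∖⁻ : ∀ lam mu {k l} → (k , l) ∈ₗ mu ∖ lam → row lam k ≤ l × l < row mu k
  ∈-∖⁻ lam mu mem
    with k′ , mem′ ← satisfied (∈-concatMap⁻ (λ k → applyUpTo (λ t → k , row lam k + t) (row mu k ∸ row lam k))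
                                            {xs = upTo (length mu)} mem)
    with t , t< , refl ← ∈-applyUpTo⁻ (λ t → k′ , row lam k′ + t) mem′
    = m≤m+n _ t , subst (_≤ row mu k′) (cong suc (+-comm t (row lam k′)))
                    (m≤o∸n⇒m+n≤o (suc t) (<⇒≤ (m∸n≢0⇒n<m λ eq → contradiction (subst (t <_) eq t<) λ ())) t<)

  -- A row without cells in the difference is unchanged; in any other row the extreme cells of the
  -- difference give the two lengths.
  ⋖⇒adds : ∀ {lam mu} → lam ⋖ mu → ∃ λ d → active d ≡ true × Adds d (row lam) (row mu)
  ⋖⇒adds {lam} {mu} (lam⊆mu , domino) = go domino refl
    where
    unchanged : ∀ {i} → (∀ {l} → ¬ (i , l) ∈ₗ mu ∖ lam) → row mu i ≡ row lam i
    unchanged {i} none = ≤-antisym (≮⇒≥ λ lt → none (∈-∖⁺ lam mu ≤-refl lt)) (lam⊆mu i)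

    -- Row i of mu extends that of lam by the columns l , … , l + n.
    extended : ∀ {i} l n → (i , l) ∈ₗ mu ∖ lam → (i , l + n) ∈ₗ mu ∖ lam →
               (∀ {x} → (i , x) ∈ₗ mu ∖ lam → l ≤ x × x ≤ l + n) →
               row lam i ≡ l × row mu i ≡ suc (l + n)
    extended {i} l n first last within =
        ≤-antisym (proj₁ (∈-∖⁻ lam mu first))
                  (proj₁ (within (∈-∖⁺ lam mu ≤-refl (≤-<-trans lam≤l (proj₂ (∈-∖⁻ lam mu first))))))
      , ≤-antisym (≮⇒≥ λ lt → <-irrefl refl (proj₂ (within (∈-∖⁺ lam mu (≤-trans lam≤l (≤-trans (m≤m+n l n) (n≤1+n _))) lt))))
                  (proj₂ (∈-∖⁻ lam mu last))
      where
      lam≤l = proj₁ (∈-∖⁻ lam mu first)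

    go : ∀ {γ} → IsDomino γ → γ ≡ mu ∖ lam → ∃ λ d → active d ≡ true × Adds d (row lam) (row mu)
    go (horizontal k l) eq = hor k , refl , adds rows′ tt
      where
      is : ∀ {i x} → (i , x) ∈ₗ mu ∖ lam → (i , x) ∈ₗ (k , l) ∷ (k , suc l) ∷ []
      is = subst (_ ∈ₗ_) (sym eq)
      row-k : row lam k ≡ l × row mu k ≡ suc (l + 1)
      row-k = extended l 1 (subst (_ ∈ₗ_) eq (here refl)) (subst (_ ∈ₗ_) eq (there (here (cong (k ,_) (+-comm l 1)))))
        λ mem → case is mem of λ where
          (here refl)         → ≤-refl , m≤m+n l 1
          (there (here refl)) → n≤1+n l , ≤-reflexive (+-comm 1 l)
      rows′ : ∀ i → row mu i ≡ inc (hor k) i + row lam i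
      rows′ i with i ≟ k
      ... | yes refl = trans (proj₂ row-k) (trans (cong suc (+-comm l 1)) (sym (cong₂ _+_ (hor-at k) (proj₁ row-k))))
      ... | no i≢k   = trans (unchanged λ mem → case is mem of λ where
        (here refl)         → i≢k refl
        (there (here refl)) → i≢k refl) (cong (_+ row lam i) (sym (hor-off i≢k)))
    go (vertical k l) eq = ver k , refl , adds rows′ (trans (proj₁ row-k) (sym (proj₁ row-k′)))
      where
      is : ∀ {i x} → (i , x) ∈ₗ mu ∖ lam → (i , x) ∈ₗ (k , l) ∷ (suc k , l) ∷ []
      is = subst (_ ∈ₗ_) (sym eq)
      row-k : row lam k ≡ l × row mu k ≡ suc (l + 0)
      row-k = extended l 0 (subst (_ ∈ₗ_) eq (here refl)) (subst (_ ∈ₗ_) eq (here (cong (k ,_) (+-identityʳ l))))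
        λ mem → case is mem of λ where
          (here refl) → ≤-refl , m≤m+n l 0
          (there (here ()))
      row-k′ : row lam (suc k) ≡ l × row mu (suc k) ≡ suc (l + 0)
      row-k′ = extended l 0 (subst (_ ∈ₗ_) eq (there (here refl))) (subst (_ ∈ₗ_) eq (there (here (cong (suc k ,_) (+-identityʳ l)))))
        λ mem → case is mem of λ where
          (here ())
          (there (here refl)) → ≤-refl , m≤m+n l 0
      rows′ : ∀ i → row mu i ≡ inc (ver k) i + row lam i
      rows′ i with i ≟ k | i ≟ suc k
      ... | yes refl | _        = trans (proj₂ row-k) (trans (cong suc (+-identityʳ l)) (sym (cong₂ _+_ (ver-at k) (proj₁ row-k))))
      ... | no _     | yes refl = trans (proj₂ row-k′) (trans (cong suc (+-identityʳ l)) (sym (cong₂ _+_ (ver-next k) (proj₁ row-k′))))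
      ... | no i≢k   | no i≢k′  = trans (unchanged λ mem → case is mem of λ where
        (here refl)         → i≢k refl
        (there (here refl)) → i≢k′ refl) (cong (_+ row lam i) (sym (ver-off i≢k i≢k′)))

  -- The local rule

  -- Besides `Flat`, the only obstruction to a partition is the row just above the domino, which
  -- must stay at least as long as the enlarged row.
  Room : Domino → (ℕ → ℕ) → Set
  Room (hor (suc k)) f = 2 + f (suc k) ≤ f k
  Room (ver (suc k)) f = 1 + f (suc k) ≤ f k
  Room _             f = ⊤

  add-decreasing : ∀ d {f} → Room d f → Flat d f → Decreasing f → Decreasing (λ i → inc d i + f i)
  add-decreasing empty               room flat dec i             = dec i
  add-decreasing (hor zero)          room flat dec zero          = ≤-trans (dec 0) (m≤n+m _ 2)
  add-decreasing (hor zero)          room flat dec (suc i)       = dec (suc i)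
  add-decreasing (hor (suc zero))    room flat dec zero          = room
  add-decreasing (hor (suc (suc k))) room flat dec zero          = dec 0
  add-decreasing (hor (suc zero))    room flat dec (suc i)       = add-decreasing (hor zero) tt tt (dec ∘ suc) i
  add-decreasing (hor (suc (suc k))) room flat dec (suc i)       = add-decreasing (hor (suc k)) room tt (dec ∘ suc) i
  add-decreasing (ver zero)          room flat dec zero          = s≤s (dec 0)
  add-decreasing (ver zero)          room flat dec (suc zero)    = ≤-trans (dec 1) (n≤1+n _)
  add-decreasing (ver zero)          room flat dec (suc (suc i)) = dec (suc (suc i))
  add-decreasing (ver (suc zero))    room flat dec zero          = room
  add-decreasing (ver (suc (suc k))) room flat dec zero          = dec 0
  add-decreasing (ver (suc zero))    room flat dec (suc i)       = add-decreasing (ver zero) tt flat (dec ∘ suc) i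
  add-decreasing (ver (suc (suc k))) room flat dec (suc i)       = add-decreasing (ver (suc k)) room flat (dec ∘ suc) i

  adds-decreasing : ∀ {d f g} → Room d f → Adds d f g → Decreasing f → Decreasing g
  adds-decreasing {d} room a dec i =
    subst₂ _≤_ (sym (rows a (suc i))) (sym (rows a i)) (add-decreasing d room (flat a) dec i)

  mkPartition : ∀ {lam} → Decreasing (row lam) → Positive lam → IsPartition lam
  mkPartition dec pos = decreasing⇒linked _ dec , pos

  appendTwoToRow-partition : ∀ k {lam} → IsPartition lam → Room (hor k) (row lam) → IsPartition (appendTwoToRow k lam)
  appendTwoToRow-partition k {lam} part@(_ , pos) room = mkPartition
    (adds-decreasing room (appendTwoToRow-adds k lam) (decreasing part))
    (addCell-positive k _ (addCell-positive k _ pos (above k room))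
      λ i<k → ≤-trans (above k room i<k) (row-addCell-≥ k (row lam k) lam _))
    where
    above : ∀ k → Room (hor k) (row lam) → ∀ {i} → i < k → 0 < row lam i
    above (suc k) room (s≤s i≤k) = ≤-trans (≤-trans z<s room) (decreasing-≤ (decreasing part) i≤k)

  appendTwoToCol-partition : ∀ l {lam} → IsPartition lam → let c = col lam l in
    row lam c ≡ l → row lam (suc c) ≡ l →
    IsPartition (appendTwoToCol l lam) × Adds (ver c) (row lam) (row (appendTwoToCol l lam))
  appendTwoToCol-partition l {lam} part@(_ , pos) eq eq′ =
      mkPartition (adds-decreasing (room c refl) a (decreasing part))
        (addCell-positive (suc c) l (addCell-positive c l pos above) above′)
    , a
    where
    c : ℕ
    c = col lam l
    a : Adds (ver c) (row lam) (row (appendTwoToCol l lam))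
    a = addTwoVertically-adds c lam eq eq′
    above : ∀ {i} → i < c → 0 < row lam i
    above i<c = ≤-<-trans z≤n (col⇒row lam (decreasing part) i<c)
    above′ : ∀ {i} → i < suc c → 0 < row (addCell (c , l) lam) i
    above′ {i} i<1+c with m<1+n⇒m<n∨m≡n i<1+c
    ... | inj₁ i<c  = ≤-trans (above i<c) (row-addCell-≥ c l lam i)
    ... | inj₂ refl = subst (0 <_) (sym (row-addCell-at c l lam)) (≤-trans z<s (m≤n⊔m _ (suc l)))
    -- `Room` reduces only at an explicit zero or successor, so c is replaced by a variable; row c -
    -- 1 is longer than l because it is counted by `col lam l`.
    room : ∀ c′ → c ≡ c′ → Room (ver c′) (row lam)
    room zero    _  = tt
    room (suc j) c≡ = subst (λ x → suc x ≤ row lam j) (trans (sym eq) (cong (row lam) c≡))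
      (col⇒row lam (decreasing part) (subst (j <_) (sym c≡) (n<1+n j)))

  cells-disjoint : ∀ {d e} → Disjoint d e → ∀ {f} → cells d f ∩ cells e f ≡ []
  cells-disjoint {d} {e} disj {f} = filter-none _ (All.map
    (λ {c} d≢0 mem → case disj (proj₁ c) of λ where
      (inj₁ eq) → d≢0 eq
      (inj₂ eq) → All.lookup (covered e) mem eq)
    (covered d))
    where
    nonzero : ∀ {x y} → x ≡ suc y → x ≢ 0
    nonzero refl ()
    covered : ∀ d → All (λ c → inc d (proj₁ c) ≢ 0) (cells d f)
    covered empty   = []
    covered (hor k) = nonzero (hor-at k) ∷ nonzero (hor-at k) ∷ []
    covered (ver k) = nonzero (ver-at k) ∷ nonzero (ver-next k) ∷ []

  ∩-idem : ∀ γ → γ ∩ γ ≡ γ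
  ∩-idem γ = filter-all _ (All.tabulate id)

  cells-topHV : ∀ k f → cells (hor k) f ∩ cells (ver k) f ≡ (k , f k) ∷ []
  cells-topHV k f = trans (filter-accept (_∈? cells (ver k) f) (here refl))
    (cong ((k , f k) ∷_) (filter-reject (_∈? cells (ver k) f) {k , suc (f k)} {[]} λ where
      (here eq)         → 1+n≢n (cong proj₂ eq)
      (there (here ()))))

  cells-topVH : ∀ k f → cells (ver k) f ∩ cells (hor k) f ≡ (k , f k) ∷ []
  cells-topVH k f = trans (filter-accept (_∈? cells (hor k) f) (here refl))
    (cong ((k , f k) ∷_) (filter-reject (_∈? cells (hor k) f) {suc k , f k} {[]} λ where
      (here ())
      (there (here ()))))

  adds-≢ : ∀ {d lam mu} → active d ≡ true → Adds d (row lam) (row mu) → lam ≢ mu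
  adds-≢ {hor k} {lam} act a refl = m≢1+n+m (row lam k) (row-at a (hor-at k))
  adds-≢ {ver k} {lam} act a refl = m≢1+n+m (row lam k) (row-at a (ver-at k))

  localRule-join : ∀ {lam mu nu d e} → active d ≡ true → active e ≡ true →
    Adds d (row lam) (row nu) → Adds e (row lam) (row mu) →
    localRule 0ℤ lam mu nu ≡ joinDominoes mu nu (cells d (row lam) ∩ cells e (row lam))
  localRule-join {lam} {mu} {nu} {d} {e} act act′ a b
    rewrite dec-false (lam ≟ᵈ mu) (adds-≢ {e} act′ b) | dec-false (lam ≟ᵈ nu) (adds-≢ {d} act a)
    = cong₂ (λ γ γ′ → joinDominoes mu nu (γ ∩ γ′)) (∖-cells {d} {lam} {nu} a) (∖-cells {e} {lam} {mu} b)

  -- In each row at least one of the two increments vanishes, so the maximum of the two lengths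
  -- accumulates both.
  disjoint-⊔ : ∀ {d e f u v} → Disjoint d e → Adds d f v → Adds e f u → ∀ i → u i ⊔ v i ≡ inc d i + u i
  disjoint-⊔ {d} {e} {f} {u} {v} disj a b i with disj i
  ... | inj₁ eq = trans (m≥n⇒m⊔n≡m (begin
      v i           ≡⟨ row-at a eq ⟩
      f i           ≤⟨ m≤n+m (f i) (inc e i) ⟩
      inc e i + f i ≡⟨ rows b i ⟨
      u i           ∎)) (cong (_+ u i) (sym eq))
    where open ≤-Reasoning
  ... | inj₂ eq = trans (cong₂ _⊔_ u≡f (rows a i)) (trans (m≤n⇒m⊔n≡n (m≤n+m (f i) (inc d i))) (cong (inc d i +_) (sym u≡f)))
    where
    u≡f : u i ≡ f i
    u≡f = row-at b eq

  disjoint-ver : ∀ {k e i} → Disjoint (ver k) e → inc (ver k) i ≡ 1 → inc e i ≡ 0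
  disjoint-ver {i = i} disj eq with disj i
  ... | inj₁ p with () ← trans (sym eq) p
  ... | inj₂ p = p

  disjoint-flat : ∀ {d e f u} → Disjoint d e → Adds e f u → Flat d f → Flat d u
  disjoint-flat {empty}     disj b _    = tt
  disjoint-flat {hor _}     disj b _    = tt
  disjoint-flat {ver k} {e} disj b flat = trans (row-at b (disjoint-ver {k} {e} disj (ver-at k)))
    (trans flat (sym (row-at b (disjoint-ver {k} {e} disj (ver-next k)))))

  Completion : ℤ → Domino → Domino → (lam mu nu rho : Diagram) → Set
  Completion m d e lam mu nu rho = IsPartition rho × ∃₂ λ d′ e′ →
    Adds d′ (row mu) (row rho) × Adds e′ (row nu) (row rho) × Rule (row lam) (row rho) m d e d′ e′

  -- As `empty` is disjoint from everything, this merges the cases lam = mu and lam = nu with that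
  -- of disjoint dominoes: each of the three branches computes the union.
  localRule-disjoint : ∀ {d e lam mu nu} → IsPartition lam → IsPartition mu → IsPartition nu →
    Adds d (row lam) (row nu) → Adds e (row lam) (row mu) → Disjoint d e →
    let rho = localRule 0ℤ lam mu nu in
    IsPartition rho × (∀ i → row rho i ≡ row mu i ⊔ row nu i)
  localRule-disjoint {d} {e} {lam} {mu} {nu} pl pm pn a b disj with lam ≟ᵈ mu
  ... | yes refl = pn , λ i → sym (m≤n⇒m⊔n≡n (adds⇒⊆ {d} {lam} {nu} a i))
  ... | no lam≢mu with lam ≟ᵈ nu
  ...   | yes refl = pm , λ i → sym (m≥n⇒m⊔n≡m (adds⇒⊆ {e} {lam} {mu} b i))
  ...   | no lam≢nu rewrite ∖-cells {d} {lam} {nu} a | ∖-cells {e} {lam} {mu} b | cells-disjoint {d} {e} disj {row lam} =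
    mkPartition (λ i → subst₂ _≤_ (sym (row-∪ mu nu (suc i))) (sym (row-∪ mu nu i)) (⊔-mono-≤ (decreasing pm i) (decreasing pn i)))
                (∪-positive (proj₂ pm) (proj₂ pn))
    , row-∪ mu nu

  complete-disjoint : ∀ {d e lam mu nu} → IsPartition lam → IsPartition mu → IsPartition nu →
    Adds d (row lam) (row nu) → Adds e (row lam) (row mu) → Disjoint d e →
    Completion 0ℤ d e lam mu nu (localRule 0ℤ lam mu nu)
  complete-disjoint {d} {e} {lam} {mu} {nu} pl pm pn a b disj
    with part , eq ← localRule-disjoint {d} {e} pl pm pn a b disj =
      part , d , e
    , adds (λ i → trans (eq i) (disjoint-⊔ {d} {e} disj a b i)) (disjoint-flat {d} {e} disj b (flat a))
    , adds (λ i → trans (eq i) (trans (⊔-comm (row mu i) (row nu i)) (disjoint-⊔ {e} {d} (disjoint-sym {d} {e} disj) b a i)))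
           (disjoint-flat {e} {d} (disjoint-sym {d} {e} disj) a (flat b))
    , disjoint disj

  -- Here u is lam with the vertical and v is lam with the horizontal of two dominoes
  -- that share the first free cell of row k.
  corner-adds : ∀ {k lam} {u v} (mu : Diagram) → Adds (ver k) (row lam) u → Adds (hor k) (row lam) v →
    (∀ i → row mu i ≡ u i ⊔ v i) → let rho = addCell (suc k , suc (row lam k)) mu in
    Adds (ver k) u (row rho) × Adds (hor (suc k)) v (row rho)
  corner-adds {k} {lam} {u} {v} mu a b eq = adds (proj₁ ∘ both) (ver-flat′ a) , adds (proj₂ ∘ both) tt
    where
    x = row lam k
    rho = addCell (suc k , suc x) mu
    below : u (suc k) ≡ 1 + x
    below = trans (row-at a (ver-next k)) (cong suc (sym (flat a)))
    below′ : v (suc k) ≡ x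
    below′ = trans (row-at b (hor-next k)) (sym (flat a))
    both : ∀ i → row rho i ≡ inc (ver k) i + u i × row rho i ≡ inc (hor (suc k)) i + v i
    both i with i ≟ suc k
    ... | yes refl = trans lhs (sym (cong₂ _+_ (ver-next k) below)) , trans lhs (sym (cong₂ _+_ (hor-at k) below′))
      where
      lhs : row rho (suc k) ≡ 2 + x
      lhs = begin
        row rho (suc k)                   ≡⟨ row-addCell-at (suc k) (suc x) mu ⟩
        row mu (suc k) ⊔ (2 + x)          ≡⟨ cong (_⊔ (2 + x)) (eq (suc k)) ⟩
        (u (suc k) ⊔ v (suc k)) ⊔ (2 + x) ≡⟨ cong₂ (λ y z → (y ⊔ z) ⊔ (2 + x)) below below′ ⟩
        ((1 + x) ⊔ x) ⊔ (2 + x)           ≡⟨ cong (_⊔ (2 + x)) (m≥n⇒m⊔n≡m (n≤1+n x)) ⟩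
        (1 + x) ⊔ (2 + x)                 ≡⟨ m≤n⇒m⊔n≡n (n≤1+n (1 + x)) ⟩
        2 + x                             ∎
        where open ≡-Reasoning
    ... | no i≢1+k with i ≟ k
    ...   | yes refl = trans lhs (sym (cong₂ _+_ (ver-at k) (row-at a (ver-at k)))) , trans lhs (sym (cong₂ _+_ (hor-prev k) (row-at b (hor-at k))))
      where
      lhs : row rho k ≡ 2 + x
      lhs = trans (row-addCell-off (suc k) (suc x) mu i≢1+k) (trans (eq k)
        (trans (cong₂ _⊔_ (row-at a (ver-at k)) (row-at b (hor-at k))) (m≤n⇒m⊔n≡n (n≤1+n (1 + x)))))
    ...   | no i≢k = trans lhs (sym (cong₂ _+_ (ver-off i≢k i≢1+k) u≡)) , trans lhs (sym (cong₂ _+_ (hor-off i≢1+k) v≡))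
      where
      u≡ : u i ≡ row lam i
      u≡ = row-at a (ver-off i≢k i≢1+k)
      v≡ : v i ≡ row lam i
      v≡ = row-at b (hor-off i≢k)
      lhs : row rho i ≡ row lam i
      lhs = trans (row-addCell-off (suc k) (suc x) mu i≢1+k) (trans (eq i) (trans (cong₂ _⊔_ u≡ v≡) (⊔-idem _)))

  -- Rows k and k + 1 were level, so the two cells added in row k leave exactly enough room for two
  -- cells beneath them.
  corner-room : ∀ {k lam v} → Adds (hor k) (row lam) v → row lam k ≡ row lam (suc k) → Room (hor (suc k)) v
  corner-room {k} {lam} b flat = ≤-reflexive (trans (cong (2 +_) (trans (row-at b (hor-next k)) (sym flat))) (sym (row-at b (hor-at k))))

  corner-partition : ∀ {k lam mu nu} → IsPartition mu → IsPartition nu →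
    Adds (ver k) (row lam) (row mu) → Adds (hor k) (row lam) (row nu) →
    ∀ kap → Positive kap → (∀ i → row kap i ≡ row mu i ⊔ row nu i) →
    IsPartition (addCell (suc k , suc (row lam k)) kap)
  corner-partition {k} {lam} {mu} {nu} pm pn a b kap pos eq =
    mkPartition (adds-decreasing (corner-room {k} {lam} b (flat a)) (proj₂ (corner-adds {k} {lam} kap a b eq)) (decreasing pn))
      (addCell-positive (suc k) _ pos above)
    where
    above : ∀ {i} → i < suc k → 0 < row kap i
    above {i} (s≤s i≤k) = begin
      1                   ≤⟨ s≤s z≤n ⟩
      2 + row lam k       ≡⟨ row-at b (hor-at k) ⟨
      row nu k            ≤⟨ decreasing-≤ (decreasing pn) i≤k ⟩
      row nu i            ≤⟨ m≤n⊔m (row mu i) (row nu i) ⟩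
      row mu i ⊔ row nu i ≡⟨ eq i ⟨
      row kap i           ∎
      where open ≤-Reasoning

  -- Each position that two addable dominoes can have selects one branch of `localRule`; the
  -- remaining positions contradict that mu and nu are partitions.
  complete : ∀ d e {lam mu nu} → IsPartition lam → IsPartition mu → IsPartition nu →
    Adds d (row lam) (row nu) → Adds e (row lam) (row mu) →
    Completion 0ℤ d e lam mu nu (localRule 0ℤ lam mu nu)
  complete d e {lam} {mu} {nu} pl pm pn a b with position d e
  ... | disjoint disj = complete-disjoint {d} {e} pl pm pn a b disj
  ... | topHV k
    rewrite localRule-join {lam} {mu} {nu} {hor k} {ver k} refl refl a b | cells-topHV k (row lam) =
      corner-partition {k} {lam} pm pn b a (mu ∪ nu) (∪-positive (proj₂ pm) (proj₂ pn)) (row-∪ mu nu)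
    , ver k , hor (suc k) , proj₁ corner , proj₂ corner , cornerHV k
    where corner = corner-adds {k} {lam} (mu ∪ nu) b a (row-∪ mu nu)
  ... | topVH k
    rewrite localRule-join {lam} {mu} {nu} {ver k} {hor k} refl refl a b | cells-topVH k (row lam) =
      corner-partition {k} {lam} pn pm a b (mu ∪ nu) (∪-positive (proj₂ pm) (proj₂ pn)) eq
    , hor (suc k) , ver k , proj₂ corner , proj₁ corner , cornerVH k
    where
    eq : ∀ i → row (mu ∪ nu) i ≡ row nu i ⊔ row mu i
    eq i = trans (row-∪ mu nu i) (⊔-comm (row mu i) (row nu i))
    corner = corner-adds {k} {lam} (mu ∪ nu) a b eq
  ... | bottomHV k = ⊥-elim (¬add-bottom (decreasing pn) (flat b) a)
  ... | bottomVH k = ⊥-elim (¬add-bottom (decreasing pm) (flat a) b)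
  ... | stackVV k  = ⊥-elim (¬add-stack (decreasing pm) (flat a) b)
  ... | stackVV′ k = ⊥-elim (¬add-stack (decreasing pn) (flat b) a)
  ... | sameH k
    rewrite localRule-join {lam} {mu} {nu} {hor k} {hor k} refl refl a b | ∩-idem (cells (hor k) (row lam))
          | isVertical-cells (hor k) (row lam)
    with refl ← partition-ext pm pn (λ i → trans (rows b i) (sym (rows a i))) =
      appendTwoToRow-partition (suc k) pn room
    , hor (suc k) , hor (suc k) , appendTwoToRow-adds (suc k) nu , appendTwoToRow-adds (suc k) nu , bumpH k
    where
    room : 2 + row nu (suc k) ≤ row nu k
    room = subst₂ (λ x y → 2 + x ≤ y) (sym (row-at a (hor-next k))) (sym (row-at a (hor-at k))) (s≤s (s≤s (decreasing pl k)))
  ... | sameV k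
    rewrite localRule-join {lam} {mu} {nu} {ver k} {ver k} refl refl a b | ∩-idem (cells (ver k) (row lam))
          | isVertical-cells (ver k) (row lam)
    with refl ← partition-ext pm pn (λ i → trans (rows b i) (sym (rows a i))) =
      proj₁ appended
    , ver c , ver c , proj₂ appended , proj₂ appended
    , bumpV k c (trans (row-at (proj₂ appended) (ver-at c)) (cong suc row-c))
    where
    l = suc (row lam k)
    c = col nu l
    dec = decreasing pn
    row-k : row nu k ≡ l
    row-k = row-at a (ver-at k)
    -- Row c is the first one of nu that is not longer than l. Rows k and k + 1 have length l, so c
    -- is at most k and all rows from c to k + 1 have length l; in particular c and c + 1 are level.
    c≤k : c ≤ k
    c≤k = ≮⇒≥ λ k<c → <-irrefl (sym row-k) (col⇒row nu dec k<c)
    row-≤ : ∀ {i} → c ≤ i → row nu i ≤ l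
    row-≤ c≤i = ≮⇒≥ λ lt → <⇒≱ (row⇒col nu dec lt) c≤i
    row-c : row nu c ≡ l
    row-c = ≤-antisym (row-≤ ≤-refl) (subst (_≤ row nu c) row-k (decreasing-≤ dec c≤k))
    row-c′ : row nu (suc c) ≡ l
    row-c′ = ≤-antisym (row-≤ (n≤1+n c))
      (subst (_≤ row nu (suc c)) (trans (sym (ver-flat′ a)) row-k) (decreasing-≤ dec (s≤s c≤k)))
    appended = appendTwoToCol-partition l pn row-c row-c′

  complete-plus : ∀ {lam} → IsPartition lam → Completion 1ℤ empty empty lam lam lam (localRule 1ℤ lam lam lam)
  complete-plus {lam} part =
      appendTwoToRow-partition 0 part tt , hor 0 , hor 0 , appendTwoToRow-adds 0 lam , appendTwoToRow-adds 0 lam , plus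

  complete-minus : ∀ {lam} → IsPartition lam → Completion -1ℤ empty empty lam lam lam (localRule -1ℤ lam lam lam)
  complete-minus {lam} part =
      proj₁ appended , ver c , ver c , proj₂ appended , proj₂ appended
    , minus c (trans (row-at (proj₂ appended) (ver-at c)) (cong suc (row-0 ≤-refl)))
    where
    c = col lam 0
    row-0 : ∀ {i} → c ≤ i → row lam i ≡ 0
    row-0 c≤i = n≤0⇒n≡0 (≮⇒≥ λ lt → <⇒≱ (row⇒col lam (decreasing part) lt) c≤i)
    appended = appendTwoToCol-partition 0 part (row-0 ≤-refl) (row-0 (n≤1+n c))

  -- The inverse of the local rule

  subtract : Domino → (ℕ → ℕ) → ℕ → ℕ
  subtract d f i = f i ∸ inc d i

  adds-cong : ∀ {d f f′ g} → (∀ i → f i ≡ f′ i) → Adds d f′ g → Adds d f g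
  adds-cong {d} eq a = adds (λ i → trans (rows a i) (cong (inc d i +_) (sym (eq i)))) (flat′ d (flat a))
    where
    flat′ : ∀ d → Flat d _ → Flat d _
    flat′ empty   flat = tt
    flat′ (hor k) flat = tt
    flat′ (ver k) flat = trans (eq k) (trans flat (sym (eq (suc k))))

  subtract-adds : ∀ d {nu} → IsPartition nu → Decreasing (subtract d (row nu)) →
    (∀ i → inc d i ≤ row nu i) → Flat d (subtract d (row nu)) →
    ∃ λ lam → IsPartition lam × Adds d (row lam) (row nu)
  subtract-adds d {nu = nu} part dec le flat
    with lam , part′ , eq ← partition-of (subtract d (row nu)) (length nu) dec
           (trans (cong (_∸ inc d (length nu)) (row-beyond nu)) (0∸n≡0 (inc d (length nu)))) =
      lam , part′ , adds-cong eq (adds (λ i → sym (m+[n∸m]≡n (le i))) flat)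

  remove-hor : ∀ k {nu} → IsPartition nu → 2 + row nu (suc k) ≤ row nu k →
    ∃ λ lam → IsPartition lam × Adds (hor k) (row lam) (row nu)
  remove-hor k {nu} part le = subtract-adds (hor k) {nu = nu} part (dec k (row nu) (decreasing part) le) (inc≤ k (row nu) le) tt
    where
    dec : ∀ k (f : ℕ → ℕ) → Decreasing f → 2 + f (suc k) ≤ f k → Decreasing (subtract (hor k) f)
    dec zero    f df le zero    = m+n≤o⇒m≤o∸n (f 1) (subst (_≤ f 0) (+-comm 2 (f 1)) le)
    dec zero    f df le (suc i) = df (suc i)
    dec (suc k) f df le zero    = ≤-trans (m∸n≤m (f 1) (inc (hor k) 0)) (df 0)
    dec (suc k) f df le (suc i) = dec k (f ∘ suc) (df ∘ suc) le i
    inc≤ : ∀ k (f : ℕ → ℕ) → 2 + f (suc k) ≤ f k → ∀ i → inc (hor k) i ≤ f i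
    inc≤ zero    f le zero    = m+n≤o⇒m≤o 2 le
    inc≤ zero    f le (suc i) = z≤n
    inc≤ (suc k) f le zero    = z≤n
    inc≤ (suc k) f le (suc i) = inc≤ k (f ∘ suc) le i

  remove-ver : ∀ k {nu} → IsPartition nu → row nu k ≡ row nu (suc k) → row nu (suc (suc k)) < row nu (suc k) →
    ∃ λ lam → IsPartition lam × Adds (ver k) (row lam) (row nu)
  remove-ver k {nu} part eq lt = subtract-adds (ver k) {nu = nu} part (dec k (row nu) (decreasing part) eq lt) (inc≤ k (row nu) eq lt)
      (cong₂ _∸_ eq (trans (ver-at k) (sym (ver-next k))))
    where
    dec : ∀ k (f : ℕ → ℕ) → Decreasing f → f k ≡ f (suc k) → f (suc (suc k)) < f (suc k) → Decreasing (subtract (ver k) f)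
    dec zero    f df eq lt zero          = ≤-reflexive (cong (_∸ 1) (sym eq))
    dec zero    f df eq lt (suc zero)    = m+n≤o⇒m≤o∸n (f 2) (subst (_≤ f 1) (+-comm 1 (f 2)) lt)
    dec zero    f df eq lt (suc (suc i)) = df (suc (suc i))
    dec (suc k) f df eq lt zero          = ≤-trans (m∸n≤m (f 1) (inc (ver k) 0)) (df 0)
    dec (suc k) f df eq lt (suc i)       = dec k (f ∘ suc) (df ∘ suc) eq lt i
    inc≤ : ∀ k (f : ℕ → ℕ) → f k ≡ f (suc k) → f (suc (suc k)) < f (suc k) → ∀ i → inc (ver k) i ≤ f i
    inc≤ zero    f eq lt zero          = subst (0 <_) (sym eq) (≤-<-trans z≤n lt)
    inc≤ zero    f eq lt (suc zero)    = ≤-<-trans z≤n lt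
    inc≤ zero    f eq lt (suc (suc i)) = z≤n
    inc≤ (suc k) f eq lt zero          = z≤n
    inc≤ (suc k) f eq lt (suc i)       = inc≤ k (f ∘ suc) eq lt i

  -- Dual to `disjoint-⊔`: the missing corner is the intersection. Where d vanishes, u agrees with h
  -- and so contains v; where e vanishes, v agrees with h.
  ⊓-adds : ∀ {d e u v h} → Disjoint d e → Adds d u h → Adds e v h → Adds d (λ i → u i ⊓ v i) v
  ⊓-adds {d} {e} {u} {v} {h} disj a b = adds rows′ (flat′ d disj a)
    where
    rows′ : ∀ i → v i ≡ inc d i + (u i ⊓ v i)
    rows′ i with disj i
    ... | inj₁ eq = sym (trans (cong (_+ (u i ⊓ v i)) eq) (m≥n⇒m⊓n≡n (begin
      v i           ≤⟨ m≤n+m (v i) (inc e i) ⟩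
      inc e i + v i ≡⟨ rows b i ⟨
      h i           ≡⟨ row-at a eq ⟩
      u i           ∎)))
      where open ≤-Reasoning
    ... | inj₂ eq = trans v≡ (cong (inc d i +_) (sym (m≤n⇒m⊓n≡m (subst (u i ≤_) (sym v≡) (m≤n+m (u i) (inc d i))))))
      where
      v≡ : v i ≡ inc d i + u i
      v≡ = trans (sym (row-at b eq)) (rows a i)
    flat′ : ∀ d → Disjoint d e → Adds d u h → Flat d (λ i → u i ⊓ v i)
    flat′ empty   _    _ = tt
    flat′ (hor k) _    _ = tt
    flat′ (ver k) disj a = cong₂ _⊓_ (flat a)
      (trans (sym (row-at b (disjoint-ver {k} {e} disj (ver-at k)))) (trans (ver-flat′ a) (row-at b (disjoint-ver {k} {e} disj (ver-next k)))))

  -- Both sides describe a 2 by 2 block, tiled by two horizontal or by two vertical dominoes.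
  inc-double : ∀ k i → inc (hor (suc k)) i + inc (hor k) i ≡ inc (ver k) i + inc (ver k) i
  inc-double zero    zero          = refl
  inc-double zero    (suc zero)    = refl
  inc-double zero    (suc (suc i)) = refl
  inc-double (suc k) zero          = refl
  inc-double (suc k) (suc i)       = inc-double k i

  -- u, v and h are f together with the horizontal in row k, the vertical in rows k, k + 1, and both.
  corner-remove : ∀ {k f u v h} → Adds (hor k) f u → Adds (hor (suc k)) u h → Adds (ver k) v h →
    2 + u (suc k) ≡ u k → Adds (ver k) f v
  corner-remove {k} {f} {u} {v} {h} a b c eq = adds
    (λ i → +-cancelˡ-≡ (inc (ver k) i) _ _ (begin
      inc (ver k) i + v i                         ≡⟨ rows c i ⟨
      h i                                         ≡⟨ rows b i ⟩
      inc (hor (suc k)) i + u i                   ≡⟨ cong (inc (hor (suc k)) i +_) (rows a i) ⟩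
      inc (hor (suc k)) i + (inc (hor k) i + f i) ≡⟨ +-assoc (inc (hor (suc k)) i) _ _ ⟨
      inc (hor (suc k)) i + inc (hor k) i + f i   ≡⟨ cong (_+ f i) (inc-double k i) ⟩
      inc (ver k) i + inc (ver k) i + f i         ≡⟨ +-assoc (inc (ver k) i) _ _ ⟩
      inc (ver k) i + (inc (ver k) i + f i)       ∎))
    (suc-injective (suc-injective (begin
      2 + f k       ≡⟨ row-at a (hor-at k) ⟨
      u k           ≡⟨ eq ⟨
      2 + u (suc k) ≡⟨ cong (2 +_) (row-at a (hor-next k)) ⟩
      2 + f (suc k) ∎)))
    where open ≡-Reasoning

  adds-empty : ∀ {f} → Adds empty f f
  adds-empty = adds (λ _ → refl) tt

  -- The rows of length x + 1 form an interval that contains c and c + 1. Its last two rows end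
  -- column x, whose height is `col nu x`, and there lies the vertical domino to be removed when one
  -- in column x + 1 is bumped back.
  last-pair : ∀ c {nu x} → IsPartition nu → row nu c ≡ suc x → row nu (suc c) ≡ suc x →
    ∃ λ k → row nu k ≡ suc x × row nu (suc k) ≡ suc x × row nu (suc (suc k)) ≤ x
  last-pair c {nu} {x} part eq eq′ = go (col nu x) refl
    where
    dec = decreasing part
    c<col : suc c < col nu x
    c<col = row⇒col nu dec (subst (x <_) (sym eq′) (n<1+n x))
    go : ∀ K → col nu x ≡ K → ∃ λ k → row nu k ≡ suc x × row nu (suc k) ≡ suc x × row nu (suc (suc k)) ≤ x
    go zero          col≡ = ⊥-elim (<⇒≱ (subst (suc c <_) col≡ c<col) z≤n)
    go (suc zero)    col≡ = ⊥-elim (<⇒≱ (subst (suc c <_) col≡ c<col) (s≤s z≤n))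
    go (suc (suc k)) col≡ = k , level c≤k (n≤1+n _) , level (≤-trans c≤k (n≤1+n k)) ≤-refl
                              , ≮⇒≥ λ lt → <-irrefl (sym col≡) (row⇒col nu dec lt)
      where
      c≤k : c ≤ k
      c≤k = s≤s⁻¹ (s≤s⁻¹ (subst (suc c <_) col≡ c<col))
      level : ∀ {i} → c ≤ i → i < 2 + k → row nu i ≡ suc x
      level {i} c≤i i<2+k = ≤-antisym (subst (row nu i ≤_) eq (decreasing-≤ dec c≤i))
                                      (col⇒row nu dec (subst (i <_) (sym col≡) i<2+k))

  -- Compared with `complete` the roles are exchanged: shared top cells are now impossible, and
  -- shared bottom cells are the outcomes of the corner cases.
  retract : ∀ d′ e′ {mu nu rho} → IsPartition mu → IsPartition nu → IsPartition rho →
    Adds d′ (row mu) (row rho) → Adds e′ (row nu) (row rho) →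
    ∃₂ λ m lam → IsPartition lam × Square m (row lam) (row mu) (row nu) (row rho)
  retract d′ e′ {mu} {nu} {rho} pm pn pr a b with position d′ e′
  ... | disjoint disj
    with lam , pl , eq ← partition-of (λ i → row mu i ⊓ row nu i) (length mu)
           (λ i → ⊓-mono-≤ (decreasing pm i) (decreasing pn i)) (cong (_⊓ row nu (length mu)) (row-beyond mu)) =
    0ℤ , lam , pl , record
      { top-adds = adds-cong eq (⊓-adds {d′} {e′} disj a b)
      ; left-adds = adds-cong (λ i → trans (eq i) (⊓-comm (row mu i) (row nu i))) (⊓-adds {e′} {d′} (disjoint-sym {d′} {e′} disj) b a)
      ; bottom-adds = a ; right-adds = b ; rule = disjoint disj }
  ... | topHV k    = ⊥-elim (¬remove-top (decreasing pm) (ver-flat′ b) a)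
  ... | topVH k    = ⊥-elim (¬remove-top (decreasing pn) (ver-flat′ a) b)
  ... | stackVV k  = ⊥-elim (¬remove-stack (decreasing pm) (ver-flat′ b) a)
  ... | stackVV′ k = ⊥-elim (¬remove-stack (decreasing pn) (ver-flat′ a) b)
  ... | bottomHV k
    with eq ← trans (sym (row-at a (hor-at (suc k)))) (trans (sym (ver-flat′ b)) (row-at a (hor-prev k)))
    with lam , pl , a′ ← remove-hor k pm (≤-reflexive eq) =
    0ℤ , lam , pl , record
      { top-adds = corner-remove a′ a b eq ; left-adds = a′ ; bottom-adds = a ; right-adds = b ; rule = cornerVH k }
  ... | bottomVH k
    with eq ← trans (sym (row-at b (hor-at (suc k)))) (trans (sym (ver-flat′ a)) (row-at b (hor-prev k)))
    with lam , pl , b′ ← remove-hor k pn (≤-reflexive eq) =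
    0ℤ , lam , pl , record
      { top-adds = b′ ; left-adds = corner-remove b′ b a eq ; bottom-adds = a ; right-adds = b ; rule = cornerHV k }
  -- No row lies above row 0 from which this domino could have been bumped, so the entry must be 1.
  ... | sameH zero
    with refl ← partition-ext pm pn (λ i → +-cancelˡ-≡ (inc (hor 0) i) _ _ (trans (sym (rows a i)) (rows b i))) =
    1ℤ , nu , pn , record { top-adds = adds-empty ; left-adds = adds-empty ; bottom-adds = a ; right-adds = b ; rule = plus }
  ... | sameH (suc k)
    with refl ← partition-ext pm pn (λ i → +-cancelˡ-≡ (inc (hor (suc k)) i) _ _ (trans (sym (rows a i)) (rows b i)))
    -- Since rho is a partition, row k of nu exceeds row k + 1 by at least two, and the bumped
    -- domino can be taken from the end of row k.
    with lam , pl , a′ ← remove-hor k pn (subst₂ _≤_ (row-at a (hor-at (suc k))) (row-at a (hor-prev k)) (decreasing pr k)) =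
    0ℤ , lam , pl , record { top-adds = a′ ; left-adds = a′ ; bottom-adds = a ; right-adds = b ; rule = bumpH k }
  ... | sameV c
    with refl ← partition-ext pm pn (λ i → +-cancelˡ-≡ (inc (ver c) i) _ _ (trans (sym (rows a i)) (rows b i)))
    with row nu c in eq
  -- Here the vertical domino lies in column 0, with no column to its left, so the entry must be -1.
  ...   | zero = -1ℤ , nu , pn , record { top-adds = adds-empty ; left-adds = adds-empty ; bottom-adds = a ; right-adds = b
                                        ; rule = minus c (trans (row-at a (ver-at c)) (cong suc eq)) }
  ...   | suc x
    with k , row-k , row-k′ , below ← last-pair c pn eq (trans (sym (flat a)) eq)
    with lam , pl , a′ ← remove-ver k pn (trans row-k (sym row-k′)) (subst (row nu (2 + k) <_) (sym row-k′) (s≤s below)) =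
    0ℤ , lam , pl , record
      { top-adds = a′ ; left-adds = a′ ; bottom-adds = a ; right-adds = b
      ; rule = bumpV k c (trans (row-at a (ver-at c)) (cong suc (trans eq (trans (sym row-k) (row-at a′ (ver-at k)))))) }

  -- Growth diagrams of matrices

  marked : ℤ → Bool
  marked (ℤ.+ 0) = false
  marked _     = true

  data Mark : ℤ → Set where
    none     : Mark 0ℤ
    positive : Mark 1ℤ
    negative : Mark -1ℤ

  unmarked : ∀ {z} → Mark z → marked z ≢ true → z ≡ 0ℤ
  unmarked none     _  = refl
  unmarked positive mk = contradiction refl mk
  unmarked negative mk = contradiction refl mk

  rule-mark : ∀ {f h m d e d′ e′} → Rule f h m d e d′ e′ → Mark m
  rule-mark (disjoint _)  = none
  rule-mark (cornerHV _)  = none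
  rule-mark (cornerVH _)  = none
  rule-mark (bumpH _)     = none
  rule-mark (bumpV _ _ _) = none
  rule-mark plus          = positive
  rule-mark (minus _ _)   = negative

  rule-unmarked : ∀ {f h m d e d′ e′} → Rule f h m d e d′ e′ → marked m ≡ true → d ≡ empty × e ≡ empty
  rule-unmarked plus        _ = refl , refl
  rule-unmarked (minus _ _) _ = refl , refl

  rule-active : ∀ {f h m d e d′ e′} → Rule f h m d e d′ e′ →
    active d′ ≡ active d ∨ marked m × active e′ ≡ active e ∨ marked m
  rule-active (disjoint _)  = sym (∨-identityʳ _) , sym (∨-identityʳ _)
  rule-active (cornerHV _)  = refl , refl
  rule-active (cornerVH _)  = refl , refl
  rule-active (bumpH _)     = refl , refl
  rule-active (bumpV _ _ _) = refl , refl
  rule-active plus          = refl , refl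
  rule-active (minus _ _)   = refl , refl

  bit : Bool → ℕ
  bit false = 0
  bit true  = 1

  negative? : ℤ → ℕ
  negative? (-[1+ _ ]) = 1
  negative? _          = 0

  rule-vertical : ∀ {f h m d e d′ e′} → Rule f h m d e d′ e′ →
    bit (vertical? d′) + bit (vertical? e′) ≡ bit (vertical? d) + bit (vertical? e) + 2 * negative? m
  rule-vertical (disjoint _)  = sym (+-identityʳ _)
  rule-vertical (cornerHV _)  = refl
  rule-vertical (cornerVH _)  = refl
  rule-vertical (bumpH _)     = refl
  rule-vertical (bumpV _ _ _) = refl
  rule-vertical plus          = refl
  rule-vertical (minus _ _)   = refl

  spin : Diagram → Diagram → ℕ
  spin lam mu = bit (isVertical (mu ∖ lam))

  spin-adds : ∀ {d lam mu} → Adds d (row lam) (row mu) → spin lam mu ≡ bit (vertical? d)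
  spin-adds {d} {lam} {mu} a = cong bit (trans (cong isVertical (∖-cells {d} {lam} {mu} a)) (isVertical-cells d (row lam)))

  DSquare : ℤ → (lam mu nu rho : Diagram) → Set
  DSquare m lam mu nu rho = Square m (row lam) (row mu) (row nu) (row rho)

  square-spin : ∀ {m lam mu nu rho} → DSquare m lam mu nu rho →
    spin mu rho + spin nu rho ≡ spin lam nu + spin lam mu + 2 * negative? m
  square-spin {m} {lam} {mu} {nu} {rho} s = begin
    spin mu rho + spin nu rho
      ≡⟨ cong₂ _+_ (spin-adds {bottom s} {mu} {rho} (bottom-adds s)) (spin-adds {right s} {nu} {rho} (right-adds s)) ⟩
    bit (vertical? (bottom s)) + bit (vertical? (right s))
      ≡⟨ rule-vertical (rule s) ⟩
    bit (vertical? (top s)) + bit (vertical? (left s)) + 2 * negative? m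
      ≡⟨ cong (_+ 2 * negative? m) (cong₂ _+_ (spin-adds {top s} {lam} {nu} (top-adds s)) (spin-adds {left s} {lam} {mu} (left-adds s))) ⟨
    spin lam nu + spin lam mu + 2 * negative? m
      ∎
    where open ≡-Reasoning

  empty-≡ : ∀ {lam mu} → IsPartition lam → IsPartition mu → Adds empty (row lam) (row mu) → lam ≡ mu
  empty-≡ pl pm a = partition-ext pl pm (sym ∘ rows a)

  completion-square : ∀ {m d e lam mu nu rho} → Adds d (row lam) (row nu) → Adds e (row lam) (row mu) →
    Completion m d e lam mu nu rho → DSquare m lam mu nu rho
  completion-square a b (_ , _ , _ , a′ , b′ , r) = record
    { top-adds = a ; left-adds = b ; bottom-adds = a′ ; right-adds = b′ ; rule = r }

  localRule-complete : ∀ {m d e lam mu nu} → IsPartition lam → IsPartition mu → IsPartition nu →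
    Adds d (row lam) (row nu) → Adds e (row lam) (row mu) →
    Mark m → (marked m ≡ true → d ≡ empty × e ≡ empty) →
    Completion m d e lam mu nu (localRule m lam mu nu)
  localRule-complete {d = d} {e} pl pm pn a b none _ = complete d e pl pm pn a b
  localRule-complete pl pm pn a b positive un
    with refl , refl ← un refl
    with refl ← empty-≡ pl pm b | refl ← empty-≡ pl pn a = complete-plus pl
  localRule-complete pl pm pn a b negative un
    with refl , refl ← un refl
    with refl ← empty-≡ pl pm b | refl ← empty-≡ pl pn a = complete-minus pl

  -- Needed after `retract`, which yields a `Rule` but no computation: `localRule` also completes
  -- the same three diagrams to a square, and determinism identifies the fourth corners.
  localRule-square : ∀ {m lam mu nu rho} → IsPartition lam → IsPartition mu → IsPartition nu → IsPartition rho →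
    DSquare m lam mu nu rho → localRule m lam mu nu ≡ rho
  localRule-square {m} {lam} {mu} {nu} {rho} pl pm pn pr s =
    partition-ext (proj₁ c) pr (square-deterministic (decreasing (proj₁ c)) (decreasing pr)
      (completion-square {m} {top s} {left s} {lam} {mu} {nu} {localRule m lam mu nu} (top-adds s) (left-adds s) c) s)
    where
    c : Completion m (top s) (left s) lam mu nu (localRule m lam mu nu)
    c = localRule-complete pl pm pn (top-adds s) (left-adds s) (rule-mark (rule s)) (rule-unmarked (rule s))

  δ-row : ∀ r i → row (δ r) i ≡ r ∸ i
  δ-row zero    i       = sym (0∸n≡0 i)
  δ-row (suc r) zero    = refl
  δ-row (suc r) (suc i) = δ-row r i

  δ-partition : ∀ r → IsPartition (δ r)
  δ-partition r = mkPartition (λ i → subst₂ _≤_ (sym (δ-row r (suc i))) (sym (δ-row r i)) (∸-monoʳ-≤ r (n≤1+n i))) (pos r)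
    where
    pos : ∀ r → Positive (δ r)
    pos zero    = []
    pos (suc r) = z<s ∷ pos r

  -- Consecutive rows of a staircase differ by at most one, so no row can lose two cells; nonempty
  -- rows are strictly longer than the next, so no two of them are level.
  δ-core : ∀ r {d lam} → IsPartition lam → Adds d (row lam) (row (δ r)) → d ≡ empty
  δ-core r {empty}     part a = refl
  δ-core r {hor k} {lam} part a = ⊥-elim (<⇒≱ (n<1+n (1 + (r ∸ suc k))) (begin
    2 + (r ∸ suc k)         ≡⟨ cong (2 +_) (δ-row r (suc k)) ⟨
    2 + row (δ r) (suc k)   ≡⟨ cong (2 +_) (row-at a (hor-next k)) ⟩
    2 + row lam (suc k)     ≤⟨ s≤s (s≤s (decreasing part k)) ⟩
    2 + row lam k           ≡⟨ row-at a (hor-at k) ⟨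
    row (δ r) k             ≡⟨ δ-row r k ⟩
    r ∸ k                   ≤⟨ m≤n+m∸n (r ∸ k) 1 ⟩
    1 + (r ∸ k ∸ 1)         ≡⟨ cong suc (trans (∸-+-assoc r k 1) (cong (r ∸_) (+-comm k 1))) ⟩
    1 + (r ∸ suc k)         ∎))
    where open ≤-Reasoning
  δ-core r {ver k} {lam} part a = ⊥-elim (<⇒≢ (∸-monoʳ-< (n<1+n k) k<r) (begin
    r ∸ suc k         ≡⟨ δ-row r (suc k) ⟨
    row (δ r) (suc k) ≡⟨ ver-flat′ a ⟨
    row (δ r) k       ≡⟨ δ-row r k ⟩
    r ∸ k             ∎))
    where
    open ≡-Reasoning
    -- Row k contains a cell of the domino, so the truncated difference is positive there and strict
    -- monotonicity applies.
    k<r : suc k ≤ r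
    k<r = m∸n≢0⇒n<m λ eq → contradiction (trans (sym (row-at a (ver-at k))) (trans (δ-row r k) eq)) λ ()

  record Edge (b : Bool) (lam mu : Diagram) : Set where
    constructor edge
    field
      {domino}   : Domino
      activity   : active domino ≡ b
      edge-adds  : Adds domino (row lam) (row mu)
  open Edge

  module Growth (r : ℕ) (m : ℕ → ℕ → ℤ) where

    G : ℕ → ℕ → Diagram
    G zero    _       = δ r
    G (suc _) zero    = δ r
    G (suc i) (suc j) = localRule (m i j) (G i j) (G (suc i) j) (G i (suc j))

    -- Running disjunctions over the entries already passed: the predicted activity of the vertical
    -- and of the horizontal side that starts at the corner (i , j).
    inRow inCol : ℕ → ℕ → Bool
    inRow i zero    = false
    inRow i (suc j) = inRow i j ∨ marked (m i j)
    inCol zero    j = false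
    inCol (suc i) j = inCol i j ∨ marked (m i j)

    G-left : ∀ i → G i 0 ≡ δ r
    G-left zero    = refl
    G-left (suc i) = refl

    -- At most one nonzero entry per row and column, in the form that `step` consumes: at a nonzero
    -- entry both known sides are inactive, so the three diagrams coincide.
    record PartialPermutation : Set where
      field
        marks  : ∀ i j → Mark (m i j)
        rowOne : ∀ i j → marked (m i j) ≡ true → inRow i j ≡ false
        colOne : ∀ i j → marked (m i j) ≡ true → inCol i j ≡ false

    module Properties (perm : PartialPermutation) where
      open PartialPermutation perm

      Row : ℕ → Set
      Row i = ∀ j → IsPartition (G i j) × Edge (inCol i j) (G i j) (G i (suc j))

      Cell′ : ℕ → ℕ → Set
      Cell′ i j = IsPartition (G (suc i) (suc j)) × DSquare (m i j) (G i j) (G (suc i) j) (G i (suc j)) (G (suc i) (suc j))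
                × Edge (inCol (suc i) j) (G (suc i) j) (G (suc i) (suc j)) × Edge (inRow i (suc j)) (G i (suc j)) (G (suc i) (suc j))

      inactive : ∀ {d} → active d ≡ false → d ≡ empty
      inactive {empty} _ = refl

      step : ∀ i j → IsPartition (G i j) → IsPartition (G (suc i) j) → IsPartition (G i (suc j)) →
        Edge (inCol i j) (G i j) (G i (suc j)) → Edge (inRow i j) (G i j) (G (suc i) j) → Cell′ i j
      step i j pl pm pn (edge {d} act a) (edge {e} act′ b)
        with c@(pr , d′ , e′ , a′ , b′ , rul) ← localRule-complete {m i j} {d} {e} pl pm pn a b (marks i j)
               (λ mk → inactive (trans act (colOne i j mk)) , inactive (trans act′ (rowOne i j mk))) =
          pr
        , completion-square {m i j} {d} {e} {G i j} {G (suc i) j} {G i (suc j)} {G (suc i) (suc j)} a b c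
        , edge (trans (proj₁ (rule-active rul)) (cong (_∨ marked (m i j)) act)) a′
        , edge (trans (proj₂ (rule-active rul)) (cong (_∨ marked (m i j)) act′)) b′

      -- The left side of the cell in column j + 1 is the right side of the cell in column j, which
      -- in turn needs its own left side.
      mutual
        next : ∀ i → Row i → ∀ j → IsPartition (G (suc i) j) × Edge (inRow i j) (G i j) (G (suc i) j)
        next i R zero    = δ-partition r , subst (λ lam → Edge false lam (δ r)) (sym (G-left i)) (edge refl adds-empty)
        next i R (suc j) with pr , _ , _ , e ← step′ i R j = pr , e

        step′ : ∀ i → Row i → ∀ j → Cell′ i j
        step′ i R j = step i j (proj₁ (R j)) (proj₁ (next i R j)) (proj₁ (R (suc j))) (proj₂ (R j)) (proj₂ (next i R j))

      rows-of : ∀ i → Row i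
      rows-of zero    j = δ-partition r , edge refl adds-empty
      rows-of (suc i) j = proj₁ (next i (rows-of i) j) , proj₁ (proj₂ (proj₂ (step′ i (rows-of i) j)))

      partition : ∀ i j → IsPartition (G i j)
      partition i j = proj₁ (rows-of i j)

      horizontalEdge : ∀ i j → Edge (inCol i j) (G i j) (G i (suc j))
      horizontalEdge i j = proj₂ (rows-of i j)

      verticalEdge : ∀ i j → Edge (inRow i j) (G i j) (G (suc i) j)
      verticalEdge i j = proj₂ (next i (rows-of i) j)

      square : ∀ i j → DSquare (m i j) (G i j) (G (suc i) j) (G i (suc j)) (G (suc i) (suc j))
      square i j = proj₁ (proj₂ (step′ i (rows-of i) j))

  -- Vertical dominoes along rows and columns of the growth diagram

  Σ : (ℕ → ℕ) → ℕ → ℕ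
  Σ f zero    = 0
  Σ f (suc n) = Σ f n + f n

  edge-spin-0 : ∀ {b lam mu} → b ≡ false → Edge b lam mu → spin lam mu ≡ 0
  edge-spin-0 {lam = lam} {mu} refl (edge {empty} _ a) = spin-adds {empty} {lam} {mu} a

  module Spin (r : ℕ) (m : ℕ → ℕ → ℤ) (perm : Growth.PartialPermutation r m) where
    open Growth r m
    open Properties perm

    rowSpin colSpin : ℕ → ℕ → ℕ
    rowSpin i n = Σ (λ j → spin (G i j) (G i (suc j))) n
    colSpin n j = Σ (λ i → spin (G i j) (G (suc i) j)) n

    rowNegatives : ℕ → ℕ → ℕ
    rowNegatives i n = Σ (λ j → negative? (m i j)) n

    -- Adding `square-spin` over a row of cells cancels the inner vertical sides; the leftmost one
    -- contributes nothing because the left border is constant.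
    rowSpin-suc : ∀ i n → rowSpin (suc i) n + spin (G i n) (G (suc i) n) ≡ rowSpin i n + 2 * rowNegatives i n
    rowSpin-suc i zero    = edge-spin-0 refl (verticalEdge i 0)
    rowSpin-suc i (suc n) = begin
      H′ + bot + rig                ≡⟨ +-assoc H′ bot rig ⟩
      H′ + (bot + rig)              ≡⟨ cong (H′ +_) (square-spin {m i n} {G i n} {G (suc i) n} {G i (suc n)} {G (suc i) (suc n)} (square i n)) ⟩
      H′ + (t + l + 2 * neg)      ≡⟨ solve 4 (λ h t l n → h :+ (t :+ l :+ con 2 :* n) := (h :+ l) :+ t :+ con 2 :* n) refl H′ t l neg ⟩
      (H′ + l) + t + 2 * neg      ≡⟨ cong (λ x → x + t + 2 * neg) (rowSpin-suc i n) ⟩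
      (H + 2 * S) + t + 2 * neg   ≡⟨ solve 4 (λ h s t n → (h :+ con 2 :* s) :+ t :+ con 2 :* n := h :+ t :+ con 2 :* (s :+ n)) refl H S t neg ⟩
      H + t + 2 * (S + neg)       ∎
      where
      open ≡-Reasoning
      open +-*-Solver
      H H′ S bot rig t l neg : ℕ
      H = rowSpin i n
      H′ = rowSpin (suc i) n
      S = rowNegatives i n
      bot = spin (G (suc i) n) (G (suc i) (suc n))
      rig = spin (G i (suc n)) (G (suc i) (suc n))
      t = spin (G i n) (G i (suc n))
      l = spin (G i n) (G (suc i) n)
      neg = negative? (m i n)

    rowSpin-zero : ∀ n → rowSpin 0 n ≡ 0
    rowSpin-zero zero    = refl
    rowSpin-zero (suc n) = cong₂ _+_ (rowSpin-zero n) (edge-spin-0 refl (horizontalEdge 0 n))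

    -- The right sides left over by `rowSpin-suc`, row after row, add up to `colSpin`, and the
    -- constant top row starts the sum at 0.
    total-spin : ∀ k n → rowSpin k n + colSpin k n ≡ 2 * Σ (λ i → rowNegatives i n) k
    total-spin zero    n = trans (+-identityʳ _) (rowSpin-zero n)
    total-spin (suc k) n = begin
      H′ + (W + l)       ≡⟨ solve 3 (λ h w l → h :+ (w :+ l) := (h :+ l) :+ w) refl H′ W l ⟩
      (H′ + l) + W       ≡⟨ cong (_+ W) (rowSpin-suc k n) ⟩
      (H + 2 * S) + W    ≡⟨ solve 3 (λ h s w → (h :+ con 2 :* s) :+ w := (h :+ w) :+ con 2 :* s) refl H S W ⟩
      (H + W) + 2 * S    ≡⟨ cong (_+ 2 * S) (total-spin k n) ⟩
      2 * T + 2 * S      ≡⟨ *-distribˡ-+ 2 T S ⟨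
      2 * (T + S)        ∎
      where
      open ≡-Reasoning
      open +-*-Solver
      H H′ W S T l : ℕ
      H = rowSpin k n
      H′ = rowSpin (suc k) n
      W = colSpin k n
      S = rowNegatives k n
      T = Σ (λ i → rowNegatives i n) k
      l = spin (G k n) (G (suc k) n)

  -- Recovering the matrix from the last row and column

  module Injective (r : ℕ) (m m′ : ℕ → ℕ → ℤ)
                   (perm : Growth.PartialPermutation r m) (perm′ : Growth.PartialPermutation r m′) where
    open Growth r m
    open Properties perm
    open Growth r m′ using () renaming (G to G′)
    open Growth.Properties r m′ perm′ using () renaming (partition to partition′; square to square′)

    cell-unique : ∀ i j → G (suc i) j ≡ G′ (suc i) j → G i (suc j) ≡ G′ i (suc j) → G (suc i) (suc j) ≡ G′ (suc i) (suc j) →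
      m i j ≡ m′ i j × G i j ≡ G′ i j
    cell-unique i j mu≡ nu≡ rho≡ = proj₁ both , partition-ext (partition i j) (partition′ i j) (proj₂ both)
      where
      s′ : DSquare (m′ i j) (G′ i j) (G (suc i) j) (G i (suc j)) (G (suc i) (suc j))
      s′ rewrite mu≡ | nu≡ | rho≡ = square′ i j
      both : m i j ≡ m′ i j × (∀ k → row (G i j) k ≡ row (G′ i j) k)
      both = square-injective (decreasing (partition i j)) (decreasing (partition′ i j))
               (decreasing (partition (suc i) j)) (decreasing (partition i (suc j))) (square i j) s′

    module _ {n} (last-row : ∀ j → j ≤ n → G n j ≡ G′ n j) (last-col : ∀ i → i ≤ n → G i n ≡ G′ i n) where

      -- Here a and b are the distances to the last row and column; a corner is recovered from its
      -- three neighbours closer to them.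
      G-unique : ∀ a b {i j} → a + i ≡ n → b + j ≡ n → G i j ≡ G′ i j
      G-unique zero    b {j = j} refl eq = last-row j (subst (j ≤_) eq (m≤n+m j b))
      G-unique (suc a) zero {i} eq  refl = last-col i (subst (i ≤_) eq (m≤n+m i (suc a)))
      G-unique (suc a) (suc b) {i} {j} eq eq′ = proj₂ (cell-unique i j
        (G-unique a (suc b) eq₁ eq′) (G-unique (suc a) b eq eq₂) (G-unique a b eq₁ eq₂))
        where
        eq₁ = trans (+-suc a i) eq
        eq₂ = trans (+-suc b j) eq′

      m-unique : ∀ {i j} → i < n → j < n → m i j ≡ m′ i j
      m-unique {i} {j} i<n j<n = proj₁ (cell-unique i j
        (G-unique (n ∸ suc i) (n ∸ j) (m∸n+n≡m i<n) (m∸n+n≡m (<⇒≤ j<n)))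
        (G-unique (n ∸ i) (n ∸ suc j) (m∸n+n≡m (<⇒≤ i<n)) (m∸n+n≡m j<n))
        (G-unique (n ∸ suc i) (n ∸ suc j) (m∸n+n≡m i<n) (m∸n+n≡m j<n)))

  -- Words and tableaux

  size : Domino → ℕ
  size empty = 0
  size _     = 2

  sum-uncons : ∀ lam → sum lam ≡ row lam 0 + sum (drop 1 lam)
  sum-uncons []        = refl
  sum-uncons (x ∷ lam) = refl

  row-drop : ∀ lam i → row (drop 1 lam) i ≡ row lam (suc i)
  row-drop []        i = refl
  row-drop (x ∷ lam) i = refl

  -- Rows are split off with `row _ 0` and `drop 1`, which also work on the empty list, because the
  -- two lists may differ in length.
  sum-rows : ∀ d lam mu → (∀ i → row mu i ≡ inc d i + row lam i) → sum mu ≡ size d + sum lam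
  sum-rows empty lam mu eq = sum-cong lam mu eq
    where
    sum-cong : ∀ lam mu → (∀ i → row mu i ≡ row lam i) → sum mu ≡ sum lam
    sum-cong []        []       eq = refl
    sum-cong []        (y ∷ mu) eq = cong₂ _+_ (eq 0) (sum-cong [] mu (eq ∘ suc))
    sum-cong (x ∷ lam) []       eq = cong₂ _+_ (eq 0) (sum-cong lam [] (eq ∘ suc))
    sum-cong (x ∷ lam) (y ∷ mu) eq = cong₂ _+_ (eq 0) (sum-cong lam mu (eq ∘ suc))
  sum-rows d@(hor zero) lam mu eq = begin
    sum mu                                ≡⟨ sum-uncons mu ⟩
    row mu 0 + sum (drop 1 mu)            ≡⟨ cong₂ _+_ (eq 0) (sum-rows empty (drop 1 lam) (drop 1 mu) eq′) ⟩
    2 + row lam 0 + sum (drop 1 lam)      ≡⟨ cong (2 +_) (sum-uncons lam) ⟨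
    2 + sum lam                           ∎
    where
    open ≡-Reasoning
    eq′ : ∀ i → row (drop 1 mu) i ≡ row (drop 1 lam) i
    eq′ i = trans (row-drop mu i) (trans (eq (suc i)) (sym (row-drop lam i)))
  sum-rows (hor (suc k)) lam mu eq = begin
    sum mu                             ≡⟨ sum-uncons mu ⟩
    row mu 0 + sum (drop 1 mu)         ≡⟨ cong₂ _+_ (eq 0) (sum-rows (hor k) (drop 1 lam) (drop 1 mu) eq′) ⟩
    row lam 0 + (2 + sum (drop 1 lam)) ≡⟨ +-comm (row lam 0) _ ⟩
    2 + (sum (drop 1 lam) + row lam 0) ≡⟨ cong (2 +_) (trans (+-comm _ (row lam 0)) (sym (sum-uncons lam))) ⟩
    2 + sum lam                        ∎
    where
    open ≡-Reasoning
    eq′ : ∀ i → row (drop 1 mu) i ≡ inc (hor k) i + row (drop 1 lam) i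
    eq′ i = trans (row-drop mu i) (trans (eq (suc i)) (cong (inc (hor k) i +_) (sym (row-drop lam i))))
  sum-rows (ver zero) lam mu eq = begin
    sum mu                                ≡⟨ sum-uncons mu ⟩
    row mu 0 + sum (drop 1 mu)            ≡⟨ cong₂ _+_ (eq 0) (sum-uncons (drop 1 mu)) ⟩
    1 + row lam 0 + (row (drop 1 mu) 0 + sum (drop 1 (drop 1 mu)))
      ≡⟨ cong (1 + row lam 0 +_) (cong₂ _+_ (trans (row-drop mu 0) (trans (eq 1) (cong suc (sym (row-drop lam 0)))))
                                            (sum-rows empty (drop 1 (drop 1 lam)) (drop 1 (drop 1 mu)) eq′)) ⟩
    1 + row lam 0 + (1 + (row (drop 1 lam) 0 + sum (drop 1 (drop 1 lam))))
      ≡⟨ cong (λ x → 1 + row lam 0 + (1 + x)) (sum-uncons (drop 1 lam)) ⟨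
    1 + row lam 0 + (1 + sum (drop 1 lam)) ≡⟨ +-suc (1 + row lam 0) _ ⟩
    2 + (row lam 0 + sum (drop 1 lam))     ≡⟨ cong (2 +_) (sum-uncons lam) ⟨
    2 + sum lam                            ∎
    where
    open ≡-Reasoning
    eq′ : ∀ i → row (drop 1 (drop 1 mu)) i ≡ row (drop 1 (drop 1 lam)) i
    eq′ i = trans (row-drop (drop 1 mu) i) (trans (row-drop mu (suc i)) (trans (eq (suc (suc i)))
            (sym (trans (row-drop (drop 1 lam) i) (row-drop lam (suc i))))))
  sum-rows (ver (suc k)) lam mu eq = begin
    sum mu                             ≡⟨ sum-uncons mu ⟩
    row mu 0 + sum (drop 1 mu)         ≡⟨ cong₂ _+_ (eq 0) (sum-rows (ver k) (drop 1 lam) (drop 1 mu) eq′) ⟩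
    row lam 0 + (2 + sum (drop 1 lam)) ≡⟨ +-comm (row lam 0) _ ⟩
    2 + (sum (drop 1 lam) + row lam 0) ≡⟨ cong (2 +_) (trans (+-comm _ (row lam 0)) (sym (sum-uncons lam))) ⟩
    2 + sum lam                        ∎
    where
    open ≡-Reasoning
    eq′ : ∀ i → row (drop 1 mu) i ≡ inc (ver k) i + row (drop 1 lam) i
    eq′ i = trans (row-drop mu i) (trans (eq (suc i)) (cong (inc (ver k) i +_) (sym (row-drop lam i))))

  edge-⋖ : ∀ {lam mu} → Edge true lam mu → lam ⋖ mu
  edge-⋖ {lam} {mu} (edge {d} act a) = adds⇒⋖ {d} {lam} {mu} act a

  edge-sum : ∀ {lam mu} → Edge true lam mu → sum mu ≡ 2 + sum lam
  edge-sum {lam} {mu} (edge {hor k} act a) = sum-rows (hor k) lam mu (rows a)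
  edge-sum {lam} {mu} (edge {ver k} act a) = sum-rows (ver k) lam mu (rows a)

  entry-mark : ∀ {n} (x : Letter n) j → Mark (entry x j)
  entry-mark (unbarred k) j with does (k Fin.≟ j)
  ... | true  = positive
  ... | false = none
  entry-mark (barred k) j with does (k Fin.≟ j)
  ... | true  = negative
  ... | false = none

  entry-marked : ∀ {n} (x : Letter n) j → marked (entry x j) ≡ true → value x ≡ j
  entry-marked (unbarred k) j mk with k Fin.≟ j
  ... | yes eq = eq
  entry-marked (barred k) j mk with k Fin.≟ j
  ... | yes eq = eq

  entry-value : ∀ {n} (x : Letter n) → marked (entry x (value x)) ≡ true
  entry-value (unbarred k) rewrite dec-true (k Fin.≟ k) refl = refl
  entry-value (barred k)   rewrite dec-true (k Fin.≟ k) refl = refl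

  module _ {n} (π : Word n) where

    -- Padding by zeros spares all inductions the bounds and is harmless: the diagram at (i , j)
    -- depends only on entries with smaller indices.
    matrix : ℕ → ℕ → ℤ
    matrix i j with i <? n | j <? n
    ... | yes i<n | yes j<n = M π (fromℕ< i<n) (fromℕ< j<n)
    ... | _       | _       = 0ℤ

    matrix-in : ∀ {i j} .(i<n : i < n) .(j<n : j < n) → matrix i j ≡ M π (fromℕ< i<n) (fromℕ< j<n)
    matrix-in {i} {j} i<n j<n with i <? n | j <? n
    ... | yes _  | yes _  = refl
    ... | no i≮n | _      = contradiction-irr i<n i≮n
    ... | yes _  | no j≮n = contradiction-irr j<n j≮n

    matrix-Fin : ∀ i j → matrix (toℕ i) (toℕ j) ≡ M π i j
    matrix-Fin i j = trans (matrix-in (Fin.toℕ<n i) (Fin.toℕ<n j)) (cong₂ (M π) (Fin.fromℕ<-toℕ i (Fin.toℕ<n i)) (Fin.fromℕ<-toℕ j (Fin.toℕ<n j)))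

    matrix-mark : ∀ i j → Mark (matrix i j)
    matrix-mark i j with i <? n | j <? n
    ... | yes i<n | yes j<n = entry-mark (lookup π (fromℕ< i<n)) (fromℕ< j<n)
    ... | yes _   | no _    = none
    ... | no _    | _       = none

    matrix-marked : ∀ i j → marked (matrix i j) ≡ true →
      ∃₂ λ (i′ : Fin n) (j′ : Fin n) → i ≡ toℕ i′ × j ≡ toℕ j′ × value (lookup π i′) ≡ j′
    matrix-marked i j mk with i <? n | j <? n
    ... | yes i<n | yes j<n = fromℕ< i<n , fromℕ< j<n , sym (Fin.toℕ-fromℕ< i<n) , sym (Fin.toℕ-fromℕ< j<n)
                            , entry-marked (lookup π (fromℕ< i<n)) (fromℕ< j<n) mk

  module _ (r : ℕ) {n} (π : Word n) where
    open Growth r (matrix π)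

    growth≡G : ∀ i j .(i≤n : i ≤ n) .(j≤n : j ≤ n) → growth r π i j i≤n j≤n ≡ G i j
    growth≡G zero    j       _   _   = refl
    growth≡G (suc i) zero    _   _   = refl
    growth≡G (suc i) (suc j) i<n j<n
      rewrite growth≡G i j (<⇒≤ i<n) (<⇒≤ j<n) | growth≡G (suc i) j i<n (<⇒≤ j<n) | growth≡G i (suc j) (<⇒≤ i<n) j<n
      = cong (λ m → localRule m (G i j) (G (suc i) j) (G i (suc j))) (sym (matrix-in π i<n j<n))

    inRow-witness : ∀ i j → inRow i j ≡ true → ∃ λ j′ → j′ < j × marked (matrix π i j′) ≡ true
    inRow-witness i (suc j) eq with inRow i j in eq′
    ... | true with j′ , j′<j , mk ← inRow-witness i j eq′ = j′ , m<n⇒m<1+n j′<j , mk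
    ... | false = j , n<1+n j , eq

    inCol-witness : ∀ i j → inCol i j ≡ true → ∃ λ i′ → i′ < i × marked (matrix π i′ j) ≡ true
    inCol-witness (suc i) j eq with inCol i j in eq′
    ... | true with i′ , i′<i , mk ← inCol-witness i j eq′ = i′ , m<n⇒m<1+n i′<i , mk
    ... | false = i , n<1+n i , eq

    inRow-marked : ∀ {i j k} → j < k → marked (matrix π i j) ≡ true → inRow i k ≡ true
    inRow-marked {i} {j} {suc k} (s≤s j≤k) mk with m≤n⇒m<n∨m≡n j≤k
    ... | inj₁ j<k  rewrite inRow-marked {i} {j} {k} j<k mk = refl
    ... | inj₂ refl rewrite mk = ∨-zeroʳ _

    inCol-marked : ∀ {i j k} → i < k → marked (matrix π i j) ≡ true → inCol k j ≡ true
    inCol-marked {i} {j} {suc k} (s≤s i≤k) mk with m≤n⇒m<n∨m≡n i≤k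
    ... | inj₁ i<k  rewrite inCol-marked {i} {j} {k} i<k mk = refl
    ... | inj₂ refl rewrite mk = ∨-zeroʳ _

    -- A position holds a single letter, which settles the rows; the columns follow from uniqueness
    -- of the position of each letter.
    permutation : π ∈ B n → PartialPermutation
    permutation π∈B = record { marks = matrix-mark π ; rowOne = rowOne ; colOne = colOne }
      where
      rowOne : ∀ i j → marked (matrix π i j) ≡ true → inRow i j ≡ false
      rowOne i j mk with inRow i j in eq
      ... | false = refl
      ... | true
        with j′ , j′<j , mk′ ← inRow-witness i j eq
        with i₁ , j₁ , refl , refl , refl ← matrix-marked π i j mk
        with i₂ , j₂ , i≡ , refl , refl ← matrix-marked π i j′ mk′
        with refl ← Fin.toℕ-injective i≡ = ⊥-elim (<-irrefl refl j′<j)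
      colOne : ∀ i j → marked (matrix π i j) ≡ true → inCol i j ≡ false
      colOne i j mk with inCol i j in eq
      ... | false = refl
      ... | true
        with i′ , i′<i , mk′ ← inCol-witness i j eq
        with i₁ , j₁ , refl , refl , v₁ ← matrix-marked π i j mk
        with i₂ , j₂ , refl , j≡ , v₂ ← matrix-marked π i′ j mk′
        with refl ← Fin.toℕ-injective j≡
        with _ , _ , uniq ← π∈B j₁
        with refl ← trans (sym (uniq v₁)) (uniq v₂) = ⊥-elim (<-irrefl refl i′<i)

    inRow-full : ∀ {i} → i < n → inRow i n ≡ true
    inRow-full i<n = inRow-marked (Fin.toℕ<n v)
      (trans (cong (λ x → marked (matrix π x (toℕ v))) (sym (Fin.toℕ-fromℕ< i<n)))
      (trans (cong marked (matrix-Fin π (fromℕ< i<n) v)) (entry-value (lookup π (fromℕ< i<n)))))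
      where v = value (lookup π (fromℕ< i<n))

    -- Every letter occurs somewhere, so each step along the last row of diagrams is a genuine
    -- domino.
    inCol-full : π ∈ B n → ∀ {j} → j < n → inCol n j ≡ true
    inCol-full π∈B {j} j<n with i , v , _ ← π∈B (fromℕ< j<n) = inCol-marked (Fin.toℕ<n i)
      (trans (cong (λ x → marked (matrix π (toℕ i) x)) (trans (sym (Fin.toℕ-fromℕ< j<n)) (cong toℕ (sym v))))
      (trans (cong marked (matrix-Fin π i (value (lookup π i)))) (entry-value (lookup π i))))

    lookup-P : ∀ k → lookup (P-tableau r π) k ≡ G n (toℕ k)
    lookup-P k = trans (lookup∘tabulate (λ j → growth r π n (toℕ j) ≤-refl (Fin.toℕ≤pred[n] j)) k) (growth≡G n (toℕ k) ≤-refl (Fin.toℕ≤pred[n] k))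

    lookup-Q : ∀ k → lookup (Q-tableau r π) k ≡ G (toℕ k) n
    lookup-Q k = trans (lookup∘tabulate (λ i → growth r π (toℕ i) n (Fin.toℕ≤pred[n] i) ≤-refl) k) (growth≡G (toℕ k) n (Fin.toℕ≤pred[n] k) ≤-refl)

    module Tableaux (π∈B : π ∈ B n) where
      open Properties (permutation π∈B)

      P-edge : ∀ {j} → j < n → Edge true (G n j) (G n (suc j))
      P-edge {j} j<n = subst (λ b → Edge b (G n j) (G n (suc j))) (inCol-full π∈B j<n) (horizontalEdge n j)

      Q-edge : ∀ {i} → i < n → Edge true (G i n) (G (suc i) n)
      Q-edge {i} i<n = subst (λ b → Edge b (G i n) (G (suc i) n)) (inRow-full i<n) (verticalEdge i n)

      two-core : ∀ j → j ≤ n → Star RemoveDomino (G n j) (δ r)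
      two-core zero    _   = subst (λ lam → Star RemoveDomino lam (δ r)) (sym (G-left n)) ε
      two-core (suc j) j<n = (partition n j , edge-⋖ (P-edge j<n)) ◅ two-core j (<⇒≤ j<n)

      sum-G : ∀ j → j ≤ n → sum (G n j) ≡ sum (δ r) + 2 * j
      sum-G zero    _   = trans (cong sum (G-left n)) (sym (+-identityʳ _))
      sum-G (suc j) j<n = begin
        sum (G n (suc j))         ≡⟨ edge-sum (P-edge j<n) ⟩
        2 + sum (G n j)           ≡⟨ cong (2 +_) (sum-G j (<⇒≤ j<n)) ⟩
        2 + (sum (δ r) + 2 * j)   ≡⟨ +-comm 2 (sum (δ r) + 2 * j) ⟩
        sum (δ r) + 2 * j + 2     ≡⟨ +-assoc (sum (δ r)) (2 * j) 2 ⟩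
        sum (δ r) + (2 * j + 2)   ≡⟨ cong (sum (δ r) +_) (trans (+-comm (2 * j) 2) (sym (*-suc 2 j))) ⟩
        sum (δ r) + 2 * suc j     ∎
        where open ≡-Reasoning

      core-stuck : ∀ mu → ¬ RemoveDomino (δ r) mu
      core-stuck mu (part , cover) with d , act , a ← ⋖⇒adds {mu} {δ r} cover with refl ← δ-core r {d} part a
        = contradiction act λ ()

      shape : G n n ∈ 𝒫 r n
      shape = partition n n , (two-core n ≤-refl , core-stuck) , sum-G n ≤-refl

      chain-SDT : (D : Chain n) (g : ℕ → Diagram) → (∀ k → lookup D k ≡ g (toℕ k)) →
        g 0 ≡ δ r → (∀ i → IsPartition (g i)) → (∀ {i} → i < n → Edge true (g i) (g (suc i))) → IsSDT r (g n) D
      chain-SDT D g eq g0 part edges =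
          trans (eq fzero) g0
        , trans (eq (fromℕ n)) (cong g (Fin.toℕ-fromℕ n))
        , (λ k → subst IsPartition (sym (eq k)) (part (toℕ k)))
        , λ k → subst₂ _⋖_ (sym (trans (eq (inject₁ k)) (cong g (Fin.toℕ-inject₁ k)))) (sym (eq (fsuc k))) (edge-⋖ (edges (Fin.toℕ<n k)))

      tableaux : (P-tableau r π , Q-tableau r π) ∈ SDTPairs r n
      tableaux = G n n , shape
        , chain-SDT (P-tableau r π) (G n) lookup-P (G-left n) (partition n) P-edge
        , chain-SDT (Q-tableau r π) (λ i → G i n) lookup-Q refl (λ i → partition i n) Q-edge

  entry-self : ∀ {n} (k : Fin n) → entry (unbarred k) k ≡ 1ℤ × entry (barred k) k ≡ -1ℤ
  entry-self k rewrite dec-true (k Fin.≟ k) refl = refl , refl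

  entry-injective : ∀ {n} (x y : Letter n) → (∀ j → entry x j ≡ entry y j) → x ≡ y
  entry-injective x y eq
    with v ← entry-marked y (value x) (trans (cong marked (sym (eq (value x)))) (entry-value x)) = go x y v (eq (value x))
    where
    go : ∀ x y → value y ≡ value x → entry x (value x) ≡ entry y (value x) → x ≡ y
    go (unbarred k) (unbarred .k) refl eq = refl
    go (barred k)   (barred .k)   refl eq = refl
    go (unbarred k) (barred .k)   refl eq =
      contradiction (trans (sym (proj₁ (entry-self k))) (trans eq (proj₂ (entry-self k)))) λ ()
    go (barred k)   (unbarred .k) refl eq =
      contradiction (trans (sym (proj₁ (entry-self k))) (trans (sym eq) (proj₂ (entry-self k)))) λ ()

  vec-ext : ∀ {A : Set} {n} (xs ys : Vec A n) → (∀ i → lookup xs i ≡ lookup ys i) → xs ≡ ys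
  vec-ext xs ys eq = trans (sym (tabulate∘lookup xs)) (trans (tabulate-cong eq) (tabulate∘lookup ys))

  growth-injective : ∀ r {n} (π σ : Word n) → π ∈ B n → σ ∈ B n →
    (P-tableau r π , Q-tableau r π) ≡ (P-tableau r σ , Q-tableau r σ) → π ≡ σ
  growth-injective r {n} π σ π∈B σ∈B eq = vec-ext π σ λ i → entry-injective (lookup π i) (lookup σ i) λ j →
    trans (sym (matrix-Fin π i j)) (trans (m-unique last-row last-col (Fin.toℕ<n i) (Fin.toℕ<n j)) (matrix-Fin σ i j))
    where
    open Injective r (matrix π) (matrix σ) (permutation r π π∈B) (permutation r σ σ∈B)
    open Growth r (matrix π) using (G)
    open Growth r (matrix σ) using () renaming (G to G′)
    last-row : ∀ j → j ≤ n → G n j ≡ G′ n j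
    last-row j j≤n = begin
      G n j                     ≡⟨ cong (G n) (Fin.toℕ-fromℕ< (s≤s j≤n)) ⟨
      G n (toℕ k)               ≡⟨ lookup-P r π k ⟨
      lookup (P-tableau r π) k  ≡⟨ cong (λ D → lookup (proj₁ D) k) eq ⟩
      lookup (P-tableau r σ) k  ≡⟨ lookup-P r σ k ⟩
      G′ n (toℕ k)              ≡⟨ cong (G′ n) (Fin.toℕ-fromℕ< (s≤s j≤n)) ⟩
      G′ n j                    ∎
      where
      open ≡-Reasoning
      k : Fin (suc n)
      k = fromℕ< (s≤s j≤n)
    last-col : ∀ i → i ≤ n → G i n ≡ G′ i n
    last-col i i≤n = begin
      G i n                     ≡⟨ cong (λ i → G i n) (Fin.toℕ-fromℕ< (s≤s i≤n)) ⟨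
      G (toℕ k) n               ≡⟨ lookup-Q r π k ⟨
      lookup (Q-tableau r π) k  ≡⟨ cong (λ D → lookup (proj₂ D) k) eq ⟩
      lookup (Q-tableau r σ) k  ≡⟨ lookup-Q r σ k ⟩
      G′ (toℕ k) n              ≡⟨ cong (λ i → G′ i n) (Fin.toℕ-fromℕ< (s≤s i≤n)) ⟩
      G′ i n                    ∎
      where
      open ≡-Reasoning
      k : Fin (suc n)
      k = fromℕ< (s≤s i≤n)

  -- Reconstruction of the word

  -- In `word` this is applied to nonzero entries, where the default branch stands for 1.
  letter : ∀ {n} → ℤ → Fin n → Letter n
  letter -[1+ _ ] k = barred k
  letter _        k = unbarred k

  value-letter : ∀ {n} z (k : Fin n) → value (letter z k) ≡ k
  value-letter (ℤ.+ _)   k = refl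
  value-letter -[1+ _ ] k = refl

  entry-letter : ∀ {n z} (k : Fin n) → Mark z → marked z ≡ true → entry (letter z k) k ≡ z
  entry-letter k positive _ = proj₁ (entry-self k)
  entry-letter k negative _ = proj₂ (entry-self k)

  entry-letter-off : ∀ {n} z {k j : Fin n} → k ≢ j → entry (letter z k) j ≡ 0ℤ
  entry-letter-off (ℤ.+ _)   {k} {j} k≢j rewrite dec-false (k Fin.≟ j) k≢j = refl
  entry-letter-off -[1+ _ ] {k} {j} k≢j rewrite dec-false (k Fin.≟ j) k≢j = refl

  localRule-cong : ∀ {m m′ lam lam′ mu mu′ nu nu′} → m ≡ m′ → lam ≡ lam′ → mu ≡ mu′ → nu ≡ nu′ →
    localRule m lam mu nu ≡ localRule m′ lam′ mu′ nu′
  localRule-cong refl refl refl refl = refl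

  WeakEdge : Diagram → Diagram → Set
  WeakEdge lam mu = ∃ λ d → Adds d (row lam) (row mu)

  -- Activity read off from the diagrams alone, so that neighbouring squares agree on a common side
  -- without comparing the dominoes chosen in each.
  changed : Diagram → Diagram → Bool
  changed lam mu = not (does (lam ≟ᵈ mu))

  changed-adds : ∀ d {lam mu} → IsPartition lam → IsPartition mu → Adds d (row lam) (row mu) → active d ≡ changed lam mu
  changed-adds empty   {lam} {mu} pl pm a = cong not (sym (dec-true (lam ≟ᵈ mu) (empty-≡ pl pm a)))
  changed-adds (hor k) {lam} {mu} pl pm a = cong not (sym (dec-false (lam ≟ᵈ mu) (adds-≢ {hor k} refl a)))
  changed-adds (ver k) {lam} {mu} pl pm a = cong not (sym (dec-false (lam ≟ᵈ mu) (adds-≢ {ver k} refl a)))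

  changed-refl : ∀ lam → changed lam lam ≡ false
  changed-refl lam = cong not (dec-true (lam ≟ᵈ lam) refl)

  -- L switches from true to false exactly at the index where M holds.
  module Switch (L M : ℕ → Bool) (switch : ∀ b → L b ≡ L (suc b) ∨ M b) (off : ∀ b → M b ≡ true → L (suc b) ≡ false) where

    exists : ∀ n → L 0 ≡ true → L n ≡ false → ∃ λ b → b < n × M b ≡ true
    exists zero    L0 Ln = contradiction (trans (sym L0) Ln) λ ()
    exists (suc n) L0 Ln with L n in eq
    ... | false with b , b<n , Mb ← exists n L0 eq = b , m<n⇒m<1+n b<n , Mb
    ... | true  = n , n<1+n n , trans (cong (_∨ M n) (sym Ln)) (trans (sym (switch n)) eq)

    stays-off : ∀ b → L b ≡ false → ∀ k → L (k + b) ≡ false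
    stays-off b eq zero    = eq
    stays-off b eq (suc k) with L (suc (k + b)) in eq′
    ... | false = refl
    ... | true  = trans (sym (cong (_∨ M (k + b)) eq′)) (trans (sym (switch (k + b))) (stays-off b eq k))

    on : ∀ b → M b ≡ true → L b ≡ true
    on b Mb = trans (switch b) (trans (cong (L (suc b) ∨_) Mb) (∨-true (L (suc b))))
      where
      ∨-true : ∀ x → x ∨ true ≡ true
      ∨-true false = refl
      ∨-true true  = refl

    no-later : ∀ {b b′} → M b ≡ true → M b′ ≡ true → ¬ b < b′
    no-later {b} {b′} Mb Mb′ b<b′ = contradiction
      (trans (sym (on b′ Mb′)) (subst (λ x → L x ≡ false) (m∸n+n≡m b<b′) (stays-off (suc b) (off b Mb) (b′ ∸ suc b)))) λ ()

    unique : ∀ {b b′} → M b ≡ true → M b′ ≡ true → b ≡ b′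
    unique Mb Mb′ = ≤-antisym (≮⇒≥ (no-later Mb′ Mb)) (≮⇒≥ (no-later Mb Mb′))

  -- Infinite, so that each further row is built by plain recursion; a tableau is continued by
  -- repeating its first diagram, which `WeakEdge` permits.
  record ShrinkingSequence (lam : Diagram) : Set where
    field
      at        : ℕ → Diagram
      start     : at 0 ≡ lam
      partition : ∀ b → IsPartition (at b)
      shrinks   : ∀ b → WeakEdge (at (suc b)) (at b)

  -- The growth diagram is recovered backwards: A a b is the diagram a rows and b columns
  -- before the last corner.
  module Retraction {rho} (P Q : ShrinkingSequence rho) where
    open ShrinkingSequence

    module Next {lam mu} (R : ShrinkingSequence mu) (part : IsPartition lam) (shr : WeakEdge lam mu) where

      Below : ℕ → Set
      Below b = ∃ λ lam′ → IsPartition lam′ × WeakEdge lam′ (at R b)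

      Corner : ∀ b → Below b → Set
      Corner b (nu , _) = ∃₂ λ m lam′ → IsPartition lam′ × DSquare m lam′ (at R (suc b)) nu (at R b)

      -- Stated for an arbitrary diagram in the new row, so that `below` can call it at its own
      -- previous value before `corner` names the square.
      corner′ : ∀ b → (x : Below b) → Corner b x
      corner′ b (_ , pn , e , a) =
        retract _ e (partition R (suc b)) pn (partition R b) (proj₂ (shrinks R b)) a

      below : ∀ b → Below b
      below zero    = lam , part , subst (WeakEdge lam) (sym (start R)) shr
      below (suc b) with m , lam′ , part′ , s ← corner′ b (below b) = lam′ , part′ , left s , left-adds s

      corner : ∀ b → Corner b (below b)
      corner b = corner′ b (below b)

      next : ShrinkingSequence lam
      next = record
        { at        = λ b → proj₁ (below b)
        ; start     = refl
        ; partition = λ b → proj₁ (proj₂ (below b))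
        ; shrinks   = λ b → let s = proj₂ (proj₂ (proj₂ (corner b))) in top s , top-adds s
        }

    rowsA : ∀ a → ShrinkingSequence (at Q a)
    rowsA zero    = subst ShrinkingSequence (sym (start Q)) P
    rowsA (suc a) = Next.next (rowsA a) (partition Q (suc a)) (shrinks Q a)

    private module N a = Next (rowsA a) (partition Q (suc a)) (shrinks Q a)

    A : ℕ → ℕ → Diagram
    A a = at (rowsA a)

    m : ℕ → ℕ → ℤ
    m a b = proj₁ (N.corner a b)

    square : ∀ a b → DSquare (m a b) (A (suc a) (suc b)) (A a (suc b)) (A (suc a) b) (A a b)
    square a b = proj₂ (proj₂ (proj₂ (N.corner a b)))

    partitionA : ∀ a b → IsPartition (A a b)
    partitionA a = partition (rowsA a)

    A-zero : ∀ b → A 0 b ≡ at P b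
    A-zero b = go (sym (start Q))
      where
      go : ∀ {lam} (eq : rho ≡ lam) → at (subst ShrinkingSequence eq P) b ≡ at P b
      go refl = refl

    A-start : ∀ a → A a 0 ≡ at Q a
    A-start a = start (rowsA a)

    left-edge : ∀ a b → WeakEdge (A (suc a) b) (A a b)
    left-edge a b = proj₂ (proj₂ (N.below a b))

    localRule-A : ∀ a b → localRule (m a b) (A (suc a) (suc b)) (A a (suc b)) (A (suc a) b) ≡ A a b
    localRule-A a b = localRule-square (partitionA (suc a) (suc b)) (partitionA a (suc b)) (partitionA (suc a) b) (partitionA a b) (square a b)

    column-change row-change : ℕ → ℕ → Bool
    row-change    a b = changed (A (suc a) b) (A a b)
    column-change b a = changed (A a (suc b)) (A a b)

    left-change : ∀ a b → active (left (square a b)) ≡ row-change a (suc b)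
    left-change a b = changed-adds _ (partitionA (suc a) (suc b)) (partitionA a (suc b)) (left-adds (square a b))

    top-change : ∀ a b → active (top (square a b)) ≡ column-change b (suc a)
    top-change a b = changed-adds _ (partitionA (suc a) (suc b)) (partitionA (suc a) b) (top-adds (square a b))

    row-switch : ∀ a b → row-change a b ≡ row-change a (suc b) ∨ marked (m a b)
    row-switch a b =
      trans (sym (changed-adds _ (partitionA (suc a) b) (partitionA a b) (right-adds (square a b))))
      (trans (proj₂ (rule-active (rule (square a b)))) (cong (_∨ marked (m a b)) (left-change a b)))

    row-off : ∀ a b → marked (m a b) ≡ true → row-change a (suc b) ≡ false
    row-off a b mk = trans (sym (left-change a b)) (cong active (proj₂ (rule-unmarked (rule (square a b)) mk)))

    column-switch : ∀ b a → column-change b a ≡ column-change b (suc a) ∨ marked (m a b)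
    column-switch b a =
      trans (sym (changed-adds _ (partitionA a (suc b)) (partitionA a b) (bottom-adds (square a b))))
      (trans (proj₁ (rule-active (rule (square a b)))) (cong (_∨ marked (m a b)) (top-change a b)))

    column-off : ∀ b a → marked (m a b) ≡ true → column-change b (suc a) ≡ false
    column-off b a mk = trans (sym (top-change a b)) (cong active (proj₁ (rule-unmarked (rule (square a b)) mk)))

    row-unique : ∀ a {b b′} → marked (m a b) ≡ true → marked (m a b′) ≡ true → b ≡ b′
    row-unique a = Switch.unique (row-change a) (λ b → marked (m a b)) (row-switch a) (row-off a)

    column-unique : ∀ b {a a′} → marked (m a b) ≡ true → marked (m a′ b) ≡ true → a ≡ a′
    column-unique b = Switch.unique (column-change b) (λ a → marked (m a b)) (column-switch b) (column-off b)

    m-mark : ∀ a b → Mark (m a b)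
    m-mark a b = rule-mark (rule (square a b))

    module Core {r n} (P-end : at P n ≡ δ r) (Q-end : at Q n ≡ δ r)
                (P-strict : ∀ b → b < n → changed (at P (suc b)) (at P b) ≡ true)
                (Q-strict : ∀ a → a < n → changed (at Q (suc a)) (at Q a) ≡ true) where

      core : ∀ {lam mu} → IsPartition lam → WeakEdge lam mu → mu ≡ δ r → lam ≡ δ r
      core part (d , a) refl with refl ← δ-core r {d} part a = empty-≡ part (δ-partition r) a

      A-top : ∀ b → A n b ≡ δ r
      A-top zero    = trans (A-start n) Q-end
      A-top (suc b) = core (partitionA n (suc b)) (shrinks (rowsA n) b) (A-top b)

      A-left : ∀ a → A a n ≡ δ r
      A-left zero    = trans (A-zero n) P-end
      A-left (suc a) = core (partitionA (suc a) n) (left-edge a n) (A-left a)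

      row-mark : ∀ a → a < n → ∃ λ b → b < n × marked (m a b) ≡ true
      row-mark a a<n = Switch.exists (row-change a) (λ b → marked (m a b)) (row-switch a) (row-off a) n
        (trans (cong₂ changed (A-start (suc a)) (A-start a)) (Q-strict a a<n))
        (trans (cong₂ changed (A-left (suc a)) (A-left a)) (changed-refl (δ r)))

      column-mark : ∀ b → b < n → ∃ λ a → a < n × marked (m a b) ≡ true
      column-mark b b<n = Switch.exists (column-change b) (λ a → marked (m a b)) (column-switch b) (column-off b) n
        (trans (cong₂ changed (A-zero (suc b)) (A-zero b)) (P-strict b b<n))
        (trans (cong₂ changed (A-top (suc b)) (A-top b)) (changed-refl (δ r)))

      -- Retraction counts from the last corner and words from the first, so place i corresponds to
      -- n - 1 - i.
      back : Fin n → ℕ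
      back i = toℕ (opposite i)

      back-injective : ∀ {i j} → back i ≡ back j → i ≡ j
      back-injective {i} {j} eq =
        trans (sym (Fin.opposite-involutive i)) (trans (cong opposite (Fin.toℕ-injective eq)) (Fin.opposite-involutive j))

      forth : ∀ {b} → b < n → Fin n
      forth b<n = opposite (fromℕ< b<n)

      back-forth : ∀ {b} (b<n : b < n) → back (forth b<n) ≡ b
      back-forth b<n = trans (cong toℕ (Fin.opposite-involutive (fromℕ< b<n))) (Fin.toℕ-fromℕ< b<n)

      abstract
        found : ∀ i → ∃ λ b → b < n × marked (m (back i) b) ≡ true
        found i = row-mark (back i) (Fin.toℕ<n (opposite i))

      letterAt : Fin n → Fin n
      letterAt i = forth (proj₁ (proj₂ (found i)))

      letterAt-marked : ∀ i → marked (m (back i) (back (letterAt i))) ≡ true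
      letterAt-marked i = trans (cong (λ b → marked (m (back i) b)) (back-forth (proj₁ (proj₂ (found i))))) (proj₂ (proj₂ (found i)))

      letterAt-unique : ∀ i j → marked (m (back i) (back j)) ≡ true → letterAt i ≡ j
      letterAt-unique i j mk = back-injective (row-unique (back i) (letterAt-marked i) mk)

      word : Word n
      word = tabulate λ i → letter (m (back i) (back (letterAt i))) (letterAt i)

      value-word : ∀ i → value (lookup word i) ≡ letterAt i
      value-word i = trans (cong value (lookup∘tabulate _ i)) (value-letter (m (back i) (back (letterAt i))) (letterAt i))

      M-word : ∀ i j → M word i j ≡ m (back i) (back j)
      M-word i j = trans (cong (λ x → entry x j) (lookup∘tabulate _ i)) (case letterAt i Fin.≟ j of λ where
        (yes refl) → entry-letter (letterAt i) (m-mark (back i) (back (letterAt i))) (letterAt-marked i)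
        (no ≢j)    → trans (entry-letter-off (m (back i) (back (letterAt i))) ≢j)
                           (sym (unmarked (m-mark (back i) (back j)) (≢j ∘ letterAt-unique i j))))

      word∈B : word ∈ B n
      word∈B k with a , a<n , mk ← column-mark (back k) (Fin.toℕ<n (opposite k)) =
          forth a<n
        , trans (value-word (forth a<n)) (letterAt-unique (forth a<n) k mk′)
        , λ {i} eq → back-injective (column-unique (back k) mk′
            (trans (cong (λ j → marked (m (back i) (back j))) (trans (sym eq) (value-word i))) (letterAt-marked i)))
        where
        mk′ : marked (m (back (forth a<n)) (back k)) ≡ true
        mk′ = trans (cong (λ a → marked (m a (back k))) (back-forth a<n)) mk

      back-fromℕ< : ∀ {i a} .(i<n : i < n) → a + suc i ≡ n → back (fromℕ< i<n) ≡ a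
      back-fromℕ< {i} {a} i<n eq = begin
        back (fromℕ< i<n)              ≡⟨ Fin.opposite-prop (fromℕ< i<n) ⟩
        n ∸ suc (toℕ (fromℕ< i<n))     ≡⟨ cong (λ x → n ∸ suc x) (Fin.toℕ-fromℕ< i<n) ⟩
        n ∸ suc i                      ≡⟨ cong (_∸ suc i) eq ⟨
        a + suc i ∸ suc i              ≡⟨ m+n∸n≡m a (suc i) ⟩
        a                              ∎
        where open ≡-Reasoning

      -- On the borders both sides are the core, by `A-top` and `A-left`; inside, `localRule-A`
      -- replays the retracted squares forwards.
      growth-A : ∀ i j .(i≤n : i ≤ n) .(j≤n : j ≤ n) a b → a + i ≡ n → b + j ≡ n → growth r word i j i≤n j≤n ≡ A a b
      growth-A zero    j       _ _ a b eq eq′ = sym (trans (cong (λ a → A a b) (trans (sym (+-identityʳ a)) eq)) (A-top b))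
      growth-A (suc i) zero    _ _ a b eq eq′ = sym (trans (cong (A a) (trans (sym (+-identityʳ b)) eq′)) (A-left a))
      growth-A (suc i) (suc j) i<n j<n a b eq eq′ = trans
        (localRule-cong
          (trans (M-word (fromℕ< i<n) (fromℕ< j<n)) (cong₂ m (back-fromℕ< i<n eq) (back-fromℕ< j<n eq′)))
          (growth-A i j (<⇒≤ i<n) (<⇒≤ j<n) (suc a) (suc b) (trans (sym (+-suc a i)) eq) (trans (sym (+-suc b j)) eq′))
          (growth-A (suc i) j i<n (<⇒≤ j<n) a (suc b) eq (trans (sym (+-suc b j)) eq′))
          (growth-A i (suc j) (<⇒≤ i<n) j<n (suc a) b (trans (sym (+-suc a i)) eq) eq′))
        (localRule-A a b)

      growth-P : ∀ j .(n≤n : n ≤ n) (j≤n : j ≤ n) → growth r word n j n≤n j≤n ≡ at P (n ∸ j)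
      growth-P j n≤n j≤n = trans (growth-A n j n≤n j≤n 0 (n ∸ j) refl (m∸n+n≡m j≤n)) (A-zero (n ∸ j))

      growth-Q : ∀ i (i≤n : i ≤ n) .(n≤n : n ≤ n) → growth r word i n i≤n n≤n ≡ at Q (n ∸ i)
      growth-Q i i≤n n≤n = trans (growth-A i n i≤n n≤n (n ∸ i) 0 (m∸n+n≡m i≤n) refl) (A-start (n ∸ i))

      preimage : ∀ {D E : Chain n} → (∀ k → at P (n ∸ toℕ k) ≡ lookup D k) → (∀ k → at Q (n ∸ toℕ k) ≡ lookup E k) →
        ∃ λ π → π ∈ B n × (P-tableau r π , Q-tableau r π) ≡ (D , E)
      preimage {D} {E} eq eq′ = word , word∈B , cong₂ _,_
        (trans (tabulate-cong λ k → trans (growth-P (toℕ k) ≤-refl (Fin.toℕ≤pred[n] k)) (eq k)) (tabulate∘lookup D))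
        (trans (tabulate-cong λ k → trans (growth-Q (toℕ k) (Fin.toℕ≤pred[n] k) ≤-refl) (eq′ k)) (tabulate∘lookup E))

  -- Tableaux read from the largest diagram downwards

  module Reversed {r n lam} (D : Chain n) (sdt : IsSDT r lam D) where

    at : ℕ → Diagram
    -- Truncated subtraction gives index 0 for all b ≥ n, which is the constant continuation by the
    -- core.
    at b = lookup D (fromℕ< (s≤s (m∸n≤m n b)))

    at-lookup : ∀ b k → n ∸ b ≡ toℕ k → at b ≡ lookup D k
    at-lookup b k eq = cong (lookup D) (Fin.toℕ-injective (trans (Fin.toℕ-fromℕ< _) eq))

    partition : ∀ b → IsPartition (at b)
    partition b = proj₁ (proj₂ (proj₂ sdt)) _

    cover : ∀ {b} → b < n → at (suc b) ⋖ at b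
    cover {b} b<n = subst₂ _⋖_
      (sym (at-lookup (suc b) (inject₁ k) (sym (trans (Fin.toℕ-inject₁ k) k≡))))
      (sym (at-lookup b (fsuc k) (sym (trans (cong suc k≡) (sym (+-∸-assoc 1 b<n))))))
      (proj₂ (proj₂ (proj₂ sdt)) k)
      where
      lt : n ∸ suc b < n
      lt = ∸-monoʳ-< z<s b<n
      k : Fin n
      k = fromℕ< lt
      k≡ : toℕ k ≡ n ∸ suc b
      k≡ = Fin.toℕ-fromℕ< lt

    shrinks : ∀ b → WeakEdge (at (suc b)) (at b)
    shrinks b with b <? n
    ... | yes b<n with d , _ , a ← ⋖⇒adds {at (suc b)} {at b} (cover b<n) = d , a
    ... | no b≮n = empty , subst (λ lam → Adds empty (row lam) (row (at b))) (at-lookup b _ eq) adds-empty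
      where
      n≤b = ≮⇒≥ b≮n
      eq : n ∸ b ≡ toℕ (fromℕ< (s≤s (m∸n≤m n (suc b))))
      eq = trans (m≤n⇒m∸n≡0 n≤b) (sym (trans (Fin.toℕ-fromℕ< _) (m≤n⇒m∸n≡0 (≤-trans n≤b (n≤1+n b)))))

    strict : ∀ b → b < n → changed (at (suc b)) (at b) ≡ true
    strict b b<n with d , act , a ← ⋖⇒adds {at (suc b)} {at b} (cover b<n) =
      trans (sym (changed-adds d (partition (suc b)) (partition b) a)) act

    end : at n ≡ δ r
    end = trans (at-lookup n fzero (n∸n≡0 n)) (proj₁ sdt)

    sequence : ShrinkingSequence lam
    sequence = record { at = at ; start = trans (at-lookup 0 (fromℕ n) (sym (Fin.toℕ-fromℕ n))) (proj₁ (proj₂ sdt))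
                      ; partition = partition ; shrinks = shrinks }

  growth-surjective : ∀ r {n lam} (D E : Chain n) → IsSDT r lam D → IsSDT r lam E →
    ∃ λ π → π ∈ B n × (P-tableau r π , Q-tableau r π) ≡ (D , E)
  growth-surjective r {n} D E D-SDT E-SDT =
    Retraction.Core.preimage D.sequence E.sequence {r} D.end E.end D.strict E.strict
      (λ k → D.at-lookup (n ∸ toℕ k) k (m∸[m∸n]≡n (Fin.toℕ≤pred[n] k)))
      (λ k → E.at-lookup (n ∸ toℕ k) k (m∸[m∸n]≡n (Fin.toℕ≤pred[n] k)))
    where
    module D = Reversed {r} D D-SDT
    module E = Reversed {r} E E-SDT

  bijection : ∀ r n → BijectionOnto (B n) (λ π → P-tableau r π , Q-tableau r π) (SDTPairs r n)
  bijection r n = record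
    { into       = λ π → Tableaux.tableaux r π
    ; injective  = growth-injective r
    ; surjective = λ (P , Q) (_ , _ , P-SDT , Q-SDT) → growth-surjective r P Q P-SDT Q-SDT
    }

  -- Spin

  -- `Σ` splits off its last term while `tabulate` splits off its first; `count-Σ` needs the latter.
  Σ-front : ∀ g n → Σ g (suc n) ≡ g 0 + Σ (g ∘ suc) n
  Σ-front g zero    = +-comm 0 (g 0)
  Σ-front g (suc n) = trans (cong (_+ g (suc n)) (Σ-front g n)) (+-assoc (g 0) _ _)

  Σ-single : ∀ g {v} n → v < n → (∀ j → j ≢ v → g j ≡ 0) → Σ g n ≡ g v
  Σ-single g {v} (suc n) (s≤s v≤n) off with m≤n⇒m<n∨m≡n v≤n
  ... | inj₁ v<n  = trans (cong₂ _+_ (Σ-single g n v<n off) (off n (>⇒≢ v<n))) (+-identityʳ _)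
  ... | inj₂ refl = cong (_+ g n) (Σ-zero n λ j j<n → off j (<⇒≢ j<n))
    where
    Σ-zero : ∀ n → (∀ j → j < n → g j ≡ 0) → Σ g n ≡ 0
    Σ-zero zero    off = refl
    Σ-zero (suc n) off = cong₂ _+_ (Σ-zero n λ j j<n → off j (m<n⇒m<1+n j<n)) (off n (n<1+n n))

  count-Σ : ∀ {A : Set} {n} (p : A → Bool) (f : Fin n → A) g → (∀ k → bit (p (f k)) ≡ g (toℕ k)) →
    countᵇ p (tabulate f) ≡ Σ g n
  count-Σ {n = zero}  p f g eq = refl
  count-Σ {n = suc n} p f g eq = trans head (trans (cong₂ _+_ (eq fzero) (count-Σ p (f ∘ fsuc) (g ∘ suc) (eq ∘ fsuc))) (sym (Σ-front g n)))
    where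
    head : countᵇ p (tabulate f) ≡ bit (p (f fzero)) + countᵇ p (tabulate (f ∘ fsuc))
    head with p (f fzero)
    ... | true  = refl
    ... | false = refl

  module _ (r : ℕ) {n} (π : Word n) (π∈B : π ∈ B n) where
    open Growth r (matrix π)
    open Spin r (matrix π) (permutation r π π∈B)

    verticals-P : verticals (P-tableau r π) ≡ rowSpin n n
    verticals-P = count-Σ _ id _ λ k → cong₂ spin
      (trans (lookup-P r π (inject₁ k)) (cong (G n) (Fin.toℕ-inject₁ k))) (lookup-P r π (fsuc k))

    verticals-Q : verticals (Q-tableau r π) ≡ colSpin n n
    verticals-Q = count-Σ _ id _ λ k → cong₂ spin
      (trans (lookup-Q r π (inject₁ k)) (cong (λ i → G i n) (Fin.toℕ-inject₁ k))) (lookup-Q r π (fsuc k))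

    -- Row i of the matrix has its only nonzero entry at the value of the letter, and the sign there
    -- is the bar.
    negatives : ∀ i → bit (isBarred (lookup π i)) ≡ rowNegatives (toℕ i) n
    negatives i = sym (trans (Σ-single _ n (Fin.toℕ<n v) off) (trans (cong negative? (matrix-Fin π i v)) (go (lookup π i))))
      where
      v : Fin n
      v = value (lookup π i)
      go : ∀ x → negative? (entry x (value x)) ≡ bit (isBarred x)
      go (unbarred k) = cong negative? (proj₁ (entry-self k))
      go (barred k)   = cong negative? (proj₂ (entry-self k))
      off : ∀ j → j ≢ toℕ v → negative? (matrix π (toℕ i) j) ≡ 0
      off j j≢v = cong negative? (unmarked (matrix-mark π (toℕ i) j) λ mk → case matrix-marked π (toℕ i) j mk of λ where
        (i′ , j′ , i≡ , refl , v≡) → j≢v (cong toℕ (trans (sym v≡) (cong (value ∘ lookup π) (sym (Fin.toℕ-injective i≡))))))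

    tc-Σ : tc π ≡ Σ (λ i → rowNegatives i n) n
    tc-Σ = trans (cong (countᵇ isBarred) (sym (tabulate∘lookup π))) (count-Σ isBarred (lookup π) _ negatives)

    verticals-tc : verticals (P-tableau r π) + verticals (Q-tableau r π) ≡ 2 * tc π
    verticals-tc = trans (cong₂ _+_ verticals-P verticals-Q) (trans (total-spin n n) (cong (2 *_) (sym tc-Σ)))

  -- Among unnormalised rationals the claim is a cross multiplication; `mkℚᵘ` stores the denominator
  -- minus one.
  halves : ∀ a b c → a + b ≡ 2 * c → (ℤ.+ c) ℚ./ 1 ≡ (ℤ.+ a) ℚ./ 2 ℚ.+ (ℤ.+ b) ℚ./ 2
  halves a b c eq = ℚ.toℚᵘ-injective (begin-equality
    ℚ.toℚᵘ ((ℤ.+ c) ℚ./ 1)                                 ≃⟨ ℚ.toℚᵘ-fromℚᵘ (ℚᵘ.mkℚᵘ (ℤ.+ c) 0) ⟩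
    ℚᵘ.mkℚᵘ (ℤ.+ c) 0                                      ≃⟨ ℚᵘ.*≡* cross ⟩
    ℚᵘ.mkℚᵘ (ℤ.+ a) 1 ℚᵘ.+ ℚᵘ.mkℚᵘ (ℤ.+ b) 1               ≃⟨ ℚᵘ.+-cong (ℚ.toℚᵘ-fromℚᵘ (ℚᵘ.mkℚᵘ (ℤ.+ a) 1)) (ℚ.toℚᵘ-fromℚᵘ (ℚᵘ.mkℚᵘ (ℤ.+ b) 1)) ⟨
    ℚ.toℚᵘ ((ℤ.+ a) ℚ./ 2) ℚᵘ.+ ℚ.toℚᵘ ((ℤ.+ b) ℚ./ 2)     ≃⟨ ℚ.toℚᵘ-homo-+ ((ℤ.+ a) ℚ./ 2) ((ℤ.+ b) ℚ./ 2) ⟨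
    ℚ.toℚᵘ ((ℤ.+ a) ℚ./ 2 ℚ.+ (ℤ.+ b) ℚ./ 2)               ∎)
    where
    open ℚᵘ.≤-Reasoning
    open ℤ.+-*-Solver
    -- The 4 is the product of the denominators of the two halves.
    cross : ℤ.+ c ℤ.* ℤ.+ 4 ≡ (ℤ.+ a ℤ.* ℤ.+ 2 ℤ.+ ℤ.+ b ℤ.* ℤ.+ 2) ℤ.* ℤ.+ 1
    cross = trans
      (solve 1 (λ c → c :* con (ℤ.+ 4) := (con (ℤ.+ 2) :* c) :* con (ℤ.+ 2)) refl (ℤ.+ c))
      (trans (cong (ℤ._* ℤ.+ 2) (trans (sym (ℤ.pos-* 2 c)) (cong ℤ.+_ (sym eq))))
      (solve 2 (λ a b → (a :+ b) :* con (ℤ.+ 2) := (a :* con (ℤ.+ 2) :+ b :* con (ℤ.+ 2)) :* con (ℤ.+ 1)) refl (ℤ.+ a) (ℤ.+ b)))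

open import Data.Nat using (ℕ)
open import Data.Integer using (+_)
open import Data.Product using (_×_; _,_)
open import Data.Rational using (_/_; _+_)
open import Relation.Binary.PropositionalEquality using (_≡_)
open import Relation.Unary using (_∈_)

theorem2p2 : (r n : ℕ) →
    BijectionOnto (B n) (λ π → P-tableau r π , Q-tableau r π) (SDTPairs r n)
    × (∀ (π : Word n) → π ∈ B n → + tc π / 1 ≡ sp (P-tableau r π) + sp (Q-tableau r π))
theorem2p2 r n = DominoGrowth.bijection r n , λ π π∈B →
  DominoGrowth.halves (verticals (P-tableau r π)) (verticals (Q-tableau r π)) (tc π) (DominoGrowth.verticals-tc r π π∈B)
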